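{- For every real $\epsilon>0$ there exists $N_0=N_0(\epsilon)$ such that the following holds. Let $G$ be a properly edge-coloured bipartite multigraph with $n\geq N_0$ colours and at least $(1+\epsilon)n$ edges of each colour. Then $G$ contains a rainbow matching using every colour.
   Context: Multigraphs are finite; parallel edges are allowed. An edge-colouring is proper if any two distinct edges sharing a vertex (in particular any two parallel edges) have different colours. A matching is a set of pairwise vertex-disjoint edges; it is rainbow if its edges have pairwise different colours. A rainbow matching uses every colour if each of the $n$ colours appears on one of its edges (so it has size $n$). -}

module Defs where

open import Data.Bool.Base using (Bool)
open import Data.Fin.Base using (Fin)
open import Data.Fin.Properties using (_≟_)
open import Data.Fin.Subset using (Subset; _∈_)
open import Data.Integer.Base using (+_)
open import Data.Nat.Base using (ℕ)
open import Data.Product.Base using (Σ-syntax; ∃-syntax; _×_; _,_)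
open import Data.Rational.Base using (ℚ; 0ℚ; 1ℚ; _+_; _-_; _*_; _<_; _≤_; _/_)
import Data.Rational.Properties as ℚ
open import Data.Sum.Base using (_⊎_; inj₁; inj₂)
open import Data.Vec.Base using (tabulate)
open import Relation.Binary.PropositionalEquality using (_≡_; _≢_; subst)
open import Relation.Nullary using (¬_; does; yes; no)

-- Real numbers as two-sided Dedekind cuts: lower q means q < x and
-- upper q means x < q.

record ℝ : Set₁ where
  field
    lower upper     : ℚ → Set
    lower-inhabited : ∃[ q ] lower q
    upper-inhabited : ∃[ q ] upper q
    lower-closed    : ∀ {p q} → p < q → lower q → lower p
    upper-closed    : ∀ {p q} → p < q → upper p → upper q
    lower-open      : ∀ {p} → lower p → ∃[ q ] (p < q × lower q)
    upper-open      : ∀ {q} → upper q → ∃[ p ] (p < q × upper p)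
    disjoint        : ∀ {q} → lower q → ¬ upper q
    located         : ∀ {p q} → p < q → lower p ⊎ upper q

open ℝ

fromℚ : ℚ → ℝ
fromℚ x = record
  { lower           = _< x
  ; upper           = x <_
  ; lower-inhabited = x - 1ℚ , subst (x - 1ℚ <_) (ℚ.+-identityʳ x) (ℚ.+-monoʳ-< x (ℚ.negative⁻¹ _))
  ; upper-inhabited = x + 1ℚ , subst (_< x + 1ℚ) (ℚ.+-identityʳ x) (ℚ.+-monoʳ-< x (ℚ.positive⁻¹ _))
  ; lower-closed    = ℚ.<-trans
  ; upper-closed    = λ p<q x<p → ℚ.<-trans x<p p<q
  ; lower-open      = λ p<x → let (q , p<q , q<x) = ℚ.<-dense p<x in q , p<q , q<x
  ; upper-open      = λ x<q → let (p , x<p , p<q) = ℚ.<-dense x<q in p , p<q , x<p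
  ; disjoint        = ℚ.<-asym
  ; located         = located-at
  }
  where
  located-at : ∀ {p q} → p < q → p < x ⊎ x < q
  located-at {p} p<q with p ℚ.<? x
  ... | yes p<x = inj₁ p<x
  ... | no  p≮x = inj₂ (ℚ.≤-<-trans (ℚ.≮⇒≥ p≮x) p<q)

infix 4 _<ᴿ_
_<ᴿ_ : ℝ → ℝ → Set
x <ᴿ y = ∃[ q ] (upper x q × lower y q)

0ᴿ : ℝ
0ᴿ = fromℚ 0ℚ

-- The real inequality (1 + ε) n ≤ m: since n ≥ 0, the real (1 + ε) n is the
-- supremum of the rationals (1 + q) n over rational q < ε.
[1+_]·_≤_ : ℝ → ℕ → ℕ → Set
[1+ ε ]· n ≤ m = ∀ q → lower ε q → (1ℚ + q) * (+ n / 1) ≤ + m / 1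

-- Edges have their own identities, so parallel edges are allowed.  The order
-- of the two ends of an edge carries no meaning.
record Multigraph : Set where
  field
    #vertices #edges : ℕ
    end₁ end₂        : Fin #edges → Fin #vertices

  Vertex Edge : Set
  Vertex = Fin #vertices
  Edge   = Fin #edges

  Incident : Vertex → Edge → Set
  Incident v e = v ≡ end₁ e ⊎ v ≡ end₂ e

  ShareVertex : Edge → Edge → Set
  ShareVertex e f = ∃[ v ] (Incident v e × Incident v f)

  Bipartite : Set
  Bipartite = Σ[ side ∈ (Vertex → Bool) ] (∀ e → side (end₁ e) ≢ side (end₂ e))

  EdgeColouring : ℕ → Set
  EdgeColouring n = Edge → Fin n

  Proper : ∀ {n} → EdgeColouring n → Set
  Proper χ = ∀ e f → e ≢ f → ShareVertex e f → χ e ≢ χ f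

  colourClass : ∀ {n} → EdgeColouring n → Fin n → Subset #edges
  colourClass χ c = tabulate (λ e → does (χ e ≟ c))

  IsMatching : Subset #edges → Set
  IsMatching M = ∀ e f → e ∈ M → f ∈ M → e ≢ f → ¬ ShareVertex e f

  IsRainbow : ∀ {n} → EdgeColouring n → Subset #edges → Set
  IsRainbow χ M = ∀ e f → e ∈ M → f ∈ M → e ≢ f → χ e ≢ χ f

  UsesEveryColour : ∀ {n} → EdgeColouring n → Subset #edges → Set
  UsesEveryColour χ M = ∀ c → ∃[ e ] (e ∈ M × χ e ≡ c)

{-# OPTIONS --safe #-}
-- Reserve a small random set of left vertices and a small random set of right vertices.
-- Every colour keeps many edges between the two sets, and still has more than n edges
-- avoiding both.  By Woolbright's alternating path argument, a rainbow matching avoiding the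
-- reserved vertices misses only boundedly many colours, and these are added greedily inside
-- the reserve.
module Submission where

open import Defs
open import Data.Nat.Base
import Data.Nat.Properties as ℕ
open import Algebra.Properties.Monoid.Sum ℕ.*-1-monoid
  using () renaming (sum to product; sum-cong-≗ to product-cong)
open import Algebra.Properties.Semiring.Sum ℕ.+-*-semiring
  using (sum; sum-cong-≗; *-distribˡ-sum; ∑-distrib-+)
open import Data.Bool.Base using (Bool; true; false; _∧_; if_then_else_; T)
open import Data.Bool.Properties using (T?)
open import Data.Empty using (⊥; ⊥-elim)
open import Data.Fin.Base using (Fin; zero; suc; inject≤; splitAt; _↑ˡ_; _↑ʳ_)
import Data.Fin.Properties as Fin
open import Data.Fin.Subset using (_∈_; ∣_∣)
open import Data.Integer.Base as ℤ using (-[1+_])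
import Data.Integer.Properties as ℤ
open import Data.Maybe.Base as Maybe using (Maybe; just; nothing)
open import Data.Maybe.Properties using (just-injective) renaming (≡-dec to Maybe-≡-dec)
open import Data.Nat.DivMod using (m≡m%n+[m/n]*n; m%n<n; m/n*n≤m; /-monoˡ-≤; m*n/n≡m)
open import Data.Nat.Tactic.RingSolver using (solve-∀)
open import Data.Product.Base using (∃-syntax; Σ-syntax; _×_; _,_; proj₁; proj₂)
open import Data.Rational.Base as ℚ using (mkℚ; 0ℚ; 1ℚ)
import Data.Rational.Properties as ℚ
open import Data.Rational.Unnormalised.Base as ℚᵘ using (mkℚᵘ)
import Data.Rational.Unnormalised.Properties as ℚᵘ
open import Data.Sum.Base using (_⊎_; inj₁; inj₂; [_,_]′)
open import Data.Unit.Base using (⊤; tt)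
open import Data.Vec.Base using (tabulate)
open import Data.Vec.Functional using (updateAt; _++_)
open import Data.Vec.Functional.Properties
  using (lookup-++ˡ; lookup-++ʳ; updateAt-updates; updateAt-minimal)
open import Data.Vec.Properties using ([]=⇒lookup; lookup⇒[]=; lookup∘tabulate)
open import Function.Base using (_∘_; const)
open import Relation.Binary.PropositionalEquality
open import Relation.Nullary
open import Relation.Nullary.Decidable using (_×-dec_; _⊎-dec_; ¬?; dec-true)
open import Relation.Unary using (Decidable)
open ℕ.≤-Reasoning

-- Augmenting paths alone cannot finish. With `n + x` edges of each colour they stop once the number
-- of missing colours times `x` is at most `n`, so a slack linear in `n` still leaves a constant
-- number of colours over. Repairing these needs more than twice that many reserved edges of every
-- colour, while the edges touching the reserve must cost less than the surplus. Colour classes may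
-- be arbitrarily large, so each is first cut to exactly `M * x` edges; a single upper bound `U`
-- then serves all colours. The right reserve is drawn after the left one, relative to the edges
-- whose left end is already reserved. In each draw the edges of one colour have distinct ends, so
-- only independent choices of points occur. The tails are bounded through the means of 2^|B ∩ R|
-- and 2^-|A ∩ R|. Base 2 keeps everything in natural numbers, and the union bound over the colours
-- costs only an additive `w` with n < 2^w.

private variable
  k n v N : ℕ

-- Counting

count : {P : Fin n → Set} → Decidable P → ℕ
count {zero}  P? = 0
count {suc n} P? with P? zero
... | yes _ = suc (count (P? ∘ suc))
... | no  _ = count (P? ∘ suc)

element : {P : Fin n → Set} (P? : Decidable P) → Fin (count P?) → Fin n
element {suc n} P? i       with P? zero
element {suc n} P? zero    | yes _ = zero
element {suc n} P? (suc i) | yes _ = suc (element (P? ∘ suc) i)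
element {suc n} P? i       | no  _ = suc (element (P? ∘ suc) i)

element-satisfies : {P : Fin n → Set} (P? : Decidable P) (i : Fin (count P?)) → P (element P? i)
element-satisfies {suc n} P? i       with P? zero
element-satisfies {suc n} P? zero    | yes p = p
element-satisfies {suc n} P? (suc i) | yes _ = element-satisfies (P? ∘ suc) i
element-satisfies {suc n} P? i       | no  _ = element-satisfies (P? ∘ suc) i

element-injective : {P : Fin n → Set} (P? : Decidable P) {i j : Fin (count P?)} →
                    element P? i ≡ element P? j → i ≡ j
element-injective {suc n} P? {i} {j} eq with P? zero
element-injective {suc n} P? {zero}  {zero}  eq | yes _ = refl
element-injective {suc n} P? {suc i} {suc j} eq | yes _ =
  cong suc (element-injective (P? ∘ suc) (Fin.suc-injective eq))
element-injective {suc n} P? {i}     {j}     eq | no  _ =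
  element-injective (P? ∘ suc) (Fin.suc-injective eq)

index : {P : Fin n → Set} (P? : Decidable P) (x : Fin n) → P x → Fin (count P?)
index {suc n} P? x       p with P? zero
index {suc n} P? zero    p | yes _  = zero
index {suc n} P? (suc x) p | yes _  = suc (index (P? ∘ suc) x p)
index {suc n} P? zero    p | no  ¬p = ⊥-elim (¬p p)
index {suc n} P? (suc x) p | no  _  = index (P? ∘ suc) x p

index-injective : {P : Fin n → Set} (P? : Decidable P) {x y : Fin n} (p : P x) (q : P y) →
                  index P? x p ≡ index P? y q → x ≡ y
index-injective {suc n} P? {x} {y} p q eq with P? zero
index-injective {suc n} P? {zero}  {zero}  p q eq | yes _  = refl
index-injective {suc n} P? {suc x} {suc y} p q eq | yes _  =
  cong suc (index-injective (P? ∘ suc) p q (Fin.suc-injective eq))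
index-injective {suc n} P? {zero}  {y}     p q eq | no  ¬p = ⊥-elim (¬p p)
index-injective {suc n} P? {suc x} {zero}  p q eq | no  ¬p = ⊥-elim (¬p q)
index-injective {suc n} P? {suc x} {suc y} p q eq | no  _  =
  cong suc (index-injective (P? ∘ suc) p q eq)

count≤n : {P : Fin n → Set} (P? : Decidable P) → count P? ≤ n
count≤n P? = Fin.injective⇒≤ (element-injective P?)

injection⇒≤count : {P : Fin n → Set} (P? : Decidable P) (f : Fin k → Fin n) →
                   (∀ {i j} → f i ≡ f j → i ≡ j) → (∀ i → P (f i)) → k ≤ count P?
injection⇒≤count P? f f-inj f∈P =
  Fin.injective⇒≤ {f = λ i → index P? (f i) (f∈P i)} (f-inj ∘ index-injective P? _ _)

-- Pigeonhole: every element of `P` has a partner in `Q`, and no partner serves two. Stated with a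
-- relation because a partner is usually extracted from the proof of `P i`.
count-↣ : ∀ {m} {P : Fin m → Set} {Q : Fin n → Set} (P? : Decidable P) (Q? : Decidable Q)
          (_∼_ : Fin m → Fin n → Set) → (∀ i → P i → ∃[ x ] (Q x × i ∼ x)) →
          (∀ {i j x} → i ∼ x → j ∼ x → i ≡ j) → count P? ≤ count Q?
count-↣ P? Q? _∼_ f ∼-inj = injection⇒≤count Q? (proj₁ ∘ g)
  (λ {i} {j} eq → element-injective P?
    (∼-inj (proj₂ (proj₂ (g i))) (subst (element P? j ∼_) (sym eq) (proj₂ (proj₂ (g j))))))
  (proj₁ ∘ proj₂ ∘ g)
  where
  g = λ i → f (element P? i) (element-satisfies P? i)

count-⊆ : {P Q : Fin n → Set} (P? : Decidable P) (Q? : Decidable Q) →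
          (∀ i → P i → Q i) → count P? ≤ count Q?
count-⊆ P? Q? P⊆Q = count-↣ P? Q? _≡_ (λ i p → i , P⊆Q i p , refl) (λ { refl refl → refl })

count-∪ : {P Q R : Fin n → Set} (P? : Decidable P) (Q? : Decidable Q) (R? : Decidable R) →
          (∀ i → P i → Q i ⊎ R i) → count P? ≤ count Q? + count R?
count-∪ {zero}  P? Q? R? _ = z≤n
count-∪ {suc n} P? Q? R? P⊆Q∪R with P? zero | Q? zero | R? zero | count-∪ (P? ∘ suc) (Q? ∘ suc) (R? ∘ suc) (P⊆Q∪R ∘ suc)
... | no  _ | no  _ | no _  | ih = ih
... | no  _ | no  _ | yes _ | ih = ℕ.≤-trans ih (ℕ.+-monoʳ-≤ _ (ℕ.n≤1+n _))
... | no  _ | yes _ | no _  | ih = ℕ.m≤n⇒m≤1+n ih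
... | no  _ | yes _ | yes _ | ih = ℕ.m≤n⇒m≤1+n (ℕ.≤-trans ih (ℕ.+-monoʳ-≤ _ (ℕ.n≤1+n _)))
... | yes _ | yes _ | no _  | ih = s≤s ih
... | yes _ | yes _ | yes _ | ih = s≤s (ℕ.≤-trans ih (ℕ.+-monoʳ-≤ _ (ℕ.n≤1+n _)))
... | yes _ | no  _ | yes _ | ih = ℕ.≤-trans (s≤s ih) (ℕ.≤-reflexive (sym (ℕ.+-suc _ _)))
... | yes p | no ¬q | no ¬r | _  = ⊥-elim ([ ¬q , ¬r ]′ (P⊆Q∪R zero p))

count-∁ : {P : Fin n → Set} (P? : Decidable P) → count P? + count (¬? ∘ P?) ≡ n
count-∁ {zero}  P? = refl
count-∁ {suc n} P? with P? zero
... | yes _ = cong suc (count-∁ (P? ∘ suc))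
... | no  _ = trans (ℕ.+-suc _ _) (cong suc (count-∁ (P? ∘ suc)))

count-singleton : (x : Fin n) → count (Fin._≟ x) ≤ 1
count-singleton x = Fin.injective⇒≤ {f = λ _ → zero {0}} λ {i} {j} _ → element-injective (Fin._≟ x)
  (trans (element-satisfies (Fin._≟ x) i) (sym (element-satisfies (Fin._≟ x) j)))

count-⊂ : {P Q : Fin n → Set} (P? : Decidable P) (Q? : Decidable Q) →
          (∀ i → P i → Q i) → ∀ {x} → ¬ P x → Q x → count P? < count Q?
count-⊂ {P = P} P? Q? P⊆Q {x} ¬Px Qx = injection⇒≤count Q? f f-inj f∈Q
  where
  f : Fin (suc (count P?)) → Fin _
  f zero    = x
  f (suc i) = element P? i
  f-inj : ∀ {i j} → f i ≡ f j → i ≡ j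
  f-inj {zero}  {zero}  _  = refl
  f-inj {zero}  {suc j} eq = ⊥-elim (¬Px (subst P (sym eq) (element-satisfies P? j)))
  f-inj {suc i} {zero}  eq = ⊥-elim (¬Px (subst P eq (element-satisfies P? i)))
  f-inj {suc i} {suc j} eq = cong suc (element-injective P? eq)
  f∈Q : ∀ i → _
  f∈Q zero    = Qx
  f∈Q (suc i) = P⊆Q _ (element-satisfies P? i)

count-excess : {P Q R : Fin n → Set} (P? : Decidable P) (Q? : Decidable Q) (R? : Decidable R) →
               count Q? + count R? < count P? → ∃[ i ] (P i × ¬ Q i × ¬ R i)
count-excess P? Q? R? lt with Fin.any? (λ i → P? i ×-dec ¬? (Q? i) ×-dec ¬? (R? i))
... | yes found = found
... | no  none  = ⊥-elim (ℕ.<⇒≱ lt (count-∪ P? Q? R? cover))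
  where
  cover : ∀ i → _
  cover i p with Q? i | R? i
  ... | yes q | _     = inj₁ q
  ... | no _  | yes r = inj₂ r
  ... | no ¬q | no ¬r = ⊥-elim (none (i , p , ¬q , ¬r))

-- Random sampling, derandomized

^-distribʳ-* : ∀ k a b → (a * b) ^ k ≡ a ^ k * b ^ k
^-distribʳ-* zero    a b = refl
^-distribʳ-* (suc k) a b =
  trans (cong (a * b *_) (^-distribʳ-* k a b)) (ℕ.[m*n]*[o*p]≡[m*o]*[n*p] a b _ _)

term≤sum : (f : Fin n → ℕ) (i : Fin n) → f i ≤ sum f
term≤sum {suc n} f zero    = ℕ.m≤m+n _ _
term≤sum {suc n} f (suc i) = ℕ.≤-trans (term≤sum (f ∘ suc) i) (ℕ.m≤n+m _ _)

sum≤* : (f : Fin n → ℕ) {k : ℕ} → (∀ i → f i ≤ k) → sum f ≤ n * k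
sum≤* {zero}  f f≤k = z≤n
sum≤* {suc n} f f≤k = ℕ.+-mono-≤ (f≤k zero) (sum≤* (f ∘ suc) (f≤k ∘ suc))

-- The unnamed index certifies a nonempty range; for an empty one the hypothesis is vacuous and
-- `k = 0` would be a counterexample.
sum-< : Fin n → (g : Fin n → ℕ) {k : ℕ} → (∀ i → n * g i < k) → sum g < k
sum-< {suc n} i g {zero}  h = ⊥-elim (ℕ.n≮0 (h i))
sum-< {suc n} _ g {suc k} h = s≤s (ℕ.*-cancelˡ-≤ (suc n)
  (ℕ.≤-trans (ℕ.≤-reflexive (*-distribˡ-sum (suc n) g)) (sum≤* _ (s≤s⁻¹ ∘ h))))

-- Method of conditional expectations, for a random set containing each point with
-- probability 1/(1+q); all quantities are multiplied by (1+q)^v.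
derandomize : ∀ v q (u : Fin k → ℕ) (w : Fin k → Fin v → Bool → ℕ) →
  Σ[ R ∈ (Fin v → Bool) ] suc q ^ v * sum (λ i → u i * product (λ x → w i x (R x)))
         ≤ sum (λ i → u i * product (λ x → w i x true + q * w i x false))
derandomize zero q u w = (λ ()) , ℕ.≤-reflexive (ℕ.*-identityˡ _)
derandomize (suc v) q u w
  with derandomize v q (λ i → u i * w i zero true)  (λ i x → w i (suc x))
     | derandomize v q (λ i → u i * w i zero false) (λ i x → w i (suc x))
... | R₁ , h₁ | R₀ , h₀ = choose (ℕ.≤-total s₁ s₀)
  where
  Q = suc q ^ v
  E = λ i → product (λ x → w i (suc x) true + q * w i (suc x) false)
  s₁ = sum (λ i → u i * w i zero true  * product (λ x → w i (suc x) (R₁ x)))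
  s₀ = sum (λ i → u i * w i zero false * product (λ x → w i (suc x) (R₀ x)))

  average : Q * s₁ + q * (Q * s₀)
            ≤ sum (λ i → u i * ((w i zero true + q * w i zero false) * E i))
  average = begin
    Q * s₁ + q * (Q * s₀)
      ≤⟨ ℕ.+-mono-≤ h₁ (ℕ.*-monoʳ-≤ q h₀) ⟩
    sum (λ i → u i * w i zero true * E i) + q * sum (λ i → u i * w i zero false * E i)
      ≡⟨ cong (sum (λ i → u i * w i zero true * E i) +_) (*-distribˡ-sum q (λ i → u i * w i zero false * E i)) ⟩
    sum (λ i → u i * w i zero true * E i) + sum (λ i → q * (u i * w i zero false * E i))
      ≡⟨ ∑-distrib-+ (λ i → u i * w i zero true * E i) _ ⟨
    sum (λ i → u i * w i zero true * E i + q * (u i * w i zero false * E i))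
      ≡⟨ sum-cong-≗ (λ i → lemma (u i) (w i zero true) (w i zero false) (E i) q) ⟩
    sum (λ i → u i * ((w i zero true + q * w i zero false) * E i)) ∎
    where
    lemma : ∀ u a b e q → u * a * e + q * (u * b * e) ≡ u * ((a + q * b) * e)
    lemma = solve-∀

  choose : s₁ ≤ s₀ ⊎ s₀ ≤ s₁ → _
  choose (inj₁ s₁≤s₀) = (λ { zero → true ; (suc x) → R₁ x }) , (begin
    suc q * Q * sum (λ i → u i * (w i zero true * product (λ x → w i (suc x) (R₁ x))))
      ≡⟨ cong (suc q * Q *_) (sum-cong-≗ (λ i → sym (ℕ.*-assoc (u i) (w i zero true) _))) ⟩
    suc q * Q * s₁
      ≡⟨ ℕ.*-assoc (suc q) Q s₁ ⟩
    Q * s₁ + q * (Q * s₁)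
      ≤⟨ ℕ.+-monoʳ-≤ (Q * s₁) (ℕ.*-monoʳ-≤ q (ℕ.*-monoʳ-≤ Q s₁≤s₀)) ⟩
    Q * s₁ + q * (Q * s₀)
      ≤⟨ average ⟩
    sum (λ i → u i * ((w i zero true + q * w i zero false) * E i)) ∎)
  choose (inj₂ s₀≤s₁) = (λ { zero → false ; (suc x) → R₀ x }) , (begin
    suc q * Q * sum (λ i → u i * (w i zero false * product (λ x → w i (suc x) (R₀ x))))
      ≡⟨ cong (suc q * Q *_) (sum-cong-≗ (λ i → sym (ℕ.*-assoc (u i) (w i zero false) _))) ⟩
    suc q * Q * s₀
      ≡⟨ ℕ.*-assoc (suc q) Q s₀ ⟩
    Q * s₀ + q * (Q * s₀)
      ≤⟨ ℕ.+-monoˡ-≤ (q * (Q * s₀)) (ℕ.*-monoʳ-≤ Q s₀≤s₁) ⟩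
    Q * s₁ + q * (Q * s₀)
      ≤⟨ average ⟩
    sum (λ i → u i * ((w i zero true + q * w i zero false) * E i)) ∎)

-- With c the count, the product is a^c * b^(v - c); the factor b^c on both sides avoids the
-- subtraction.
product-if : {P : Fin v → Set} (P? : Decidable P) (a b : ℕ) →
  product (λ x → if does (P? x) then a else b) * b ^ count P? ≡ a ^ count P? * b ^ v
product-if {zero}  P? a b = refl
product-if {suc v} P? a b with P? zero
... | yes _ = trans (lemma a b (product (λ x → if does (P? (suc x)) then a else b)) (b ^ count (P? ∘ suc))) (trans (cong (λ z → a * b * z) (product-if (P? ∘ suc) a b)) (lemma′ a b (a ^ count (P? ∘ suc)) (b ^ v)))
  where
  lemma : ∀ a b p c → a * p * (b * c) ≡ a * b * (p * c)
  lemma = solve-∀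
  lemma′ : ∀ a b p c → a * b * (p * c) ≡ a * p * (b * c)
  lemma′ = solve-∀
... | no  _ = trans (ℕ.*-assoc b _ _) (trans (cong (b *_) (product-if (P? ∘ suc) a b)) (lemma b (a ^ count (P? ∘ suc)) (b ^ v)))
  where
  lemma : ∀ b p c → b * (p * c) ≡ p * (b * c)
  lemma = solve-∀

-- When points are chosen with probability 1/(1+q), 2^-|A ∩ R| has mean ((1+2q)/(2+2q))^|A| and 2^|B
-- ∩ R| has mean ((2+q)/(1+q))^|B|. By Markov's inequality the two hypotheses make each failure less
-- likely than 1/(2n), which suffices for 2n events.
module _ {n v : ℕ} {A B : Fin n → Fin v → Set}
  (A? : ∀ c → Decidable (A c)) (B? : ∀ c → Decidable (B c)) (q t U : ℕ)
  (A-large : ∀ c → n * 2 ^ t * (1 + q * 2) ^ count (A? c) < (2 + q * 2) ^ count (A? c))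
  (B-small : ∀ c → n * (2 + q) ^ count (B? c) < (1 + q) ^ count (B? c) * 2 ^ U)
  where

  private
    -- Multiplied over all points, `wᴬ c` gives 2^(v - |A c ∩ R|) and `wᴮ c` gives 2^|B c ∩ R|; the
    -- former carries a factor 2^v to stay integral.
    wᴬ wᴮ : Fin n → Fin v → Bool → ℕ
    wᴬ c x b = if does (A? c x) ∧ b then 1 else 2
    wᴮ c x b = if does (B? c x) ∧ b then 2 else 1

    -- Scaled so that every failure, of either kind, forces a term of at least 2^(1+U+v).
    u : Fin (n + n) → ℕ
    u = (λ (_ : Fin n) → 2 ^ (U + t)) ++ (λ _ → 2 ^ v)

    expectedᴬ : ∀ c → product (λ x → wᴬ c x true + q * wᴬ c x false) * (2 + q * 2) ^ count (A? c)
                      ≡ (1 + q * 2) ^ count (A? c) * (2 + q * 2) ^ v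
    expectedᴬ c = trans (cong (_* (2 + q * 2) ^ count (A? c)) (product-cong pointwise)) (product-if (A? c) _ _)
      where
      pointwise : ∀ x → wᴬ c x true + q * wᴬ c x false ≡ (if does (A? c x) then 1 + q * 2 else 2 + q * 2)
      pointwise x with does (A? c x)
      ... | true  = refl
      ... | false = refl

    expectedᴮ : ∀ c → product (λ x → wᴮ c x true + q * wᴮ c x false) * (1 + q) ^ count (B? c)
                      ≡ (2 + q) ^ count (B? c) * (1 + q) ^ v
    expectedᴮ c = trans (cong (_* (1 + q) ^ count (B? c)) (product-cong pointwise)) (product-if (B? c) _ _)
      where
      pointwise : ∀ x → wᴮ c x true + q * wᴮ c x false ≡ (if does (B? c x) then 2 + q else 1 + q)
      pointwise x with does (B? c x)
      ... | true  = cong (2 +_) (ℕ.*-identityʳ q)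
      ... | false = cong (1 +_) (ℕ.*-identityʳ q)

    2^ : ∀ a b → 2 ^ (a + b) ≡ 2 ^ a * 2 ^ b
    2^ = ℕ.^-distribˡ-+-* 2

    -- Fewer than `t` means at most t - 1, and more than `U` at least U + 1. The resulting factor 2,
    -- visible as `suc U`, pays for having `n + n` events rather than `n`.
    boundᴬ : ∀ c → (n + n) * (2 ^ (U + t) * product (λ x → wᴬ c x true + q * wᴬ c x false))
                   < suc q ^ v * 2 ^ (suc U + v)
    boundᴬ c = ℕ.*-cancelʳ-< ((2 + q * 2) ^ a) _ _ (begin-strict
      (n + n) * (2 ^ (U + t) * E) * (2 + q * 2) ^ a
        ≡⟨ cong (λ z → (n + n) * (z * E) * (2 + q * 2) ^ a) (2^ U t) ⟩
      (n + n) * (2 ^ U * 2 ^ t * E) * (2 + q * 2) ^ a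
        ≡⟨ l₁ n (2 ^ U) (2 ^ t) E ((2 + q * 2) ^ a) ⟩
      2 * 2 ^ U * (n * 2 ^ t) * (E * (2 + q * 2) ^ a)
        ≡⟨ cong (2 * 2 ^ U * (n * 2 ^ t) *_) (expectedᴬ c) ⟩
      2 * 2 ^ U * (n * 2 ^ t) * ((1 + q * 2) ^ a * (2 + q * 2) ^ v)
        ≡⟨ l₂ (2 ^ U) (n * 2 ^ t) ((1 + q * 2) ^ a) ((2 + q * 2) ^ v) ⟩
      2 * 2 ^ U * (2 + q * 2) ^ v * (n * 2 ^ t * (1 + q * 2) ^ a)
        <⟨ ℕ.*-monoʳ-< (2 * 2 ^ U * (2 + q * 2) ^ v) {{nz}} (A-large c) ⟩
      2 * 2 ^ U * (2 + q * 2) ^ v * (2 + q * 2) ^ a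
        ≡⟨ cong (λ z → 2 * 2 ^ U * z * (2 + q * 2) ^ a) (^-distribʳ-* v (1 + q) 2) ⟩
      2 * 2 ^ U * ((1 + q) ^ v * 2 ^ v) * (2 + q * 2) ^ a
        ≡⟨ cong (_* (2 + q * 2) ^ a) (l₃ (2 * 2 ^ U) ((1 + q) ^ v) (2 ^ v)) ⟩
      (1 + q) ^ v * (2 * 2 ^ U * 2 ^ v) * (2 + q * 2) ^ a
        ≡⟨ cong (λ z → (1 + q) ^ v * z * (2 + q * 2) ^ a) (2^ (suc U) v) ⟨
      suc q ^ v * 2 ^ (suc U + v) * (2 + q * 2) ^ a ∎)
      where
      a = count (A? c)
      E = product (λ x → wᴬ c x true + q * wᴬ c x false)
      nz : NonZero (2 * 2 ^ U * (2 + q * 2) ^ v)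
      nz = ℕ.m*n≢0 _ _ {{ℕ.m^n≢0 2 (suc U)}} {{ℕ.m^n≢0 (2 + q * 2) v}}
      l₁ : ∀ n a b e d → (n + n) * (a * b * e) * d ≡ 2 * a * (n * b) * (e * d)
      l₁ = solve-∀
      l₂ : ∀ a b c d → 2 * a * b * (c * d) ≡ 2 * a * d * (b * c)
      l₂ = solve-∀
      l₃ : ∀ a b c → a * (b * c) ≡ b * (a * c)
      l₃ = solve-∀

    boundᴮ : ∀ c → (n + n) * (2 ^ v * product (λ x → wᴮ c x true + q * wᴮ c x false))
                   < suc q ^ v * 2 ^ (suc U + v)
    boundᴮ c = ℕ.*-cancelʳ-< ((1 + q) ^ b) _ _ (begin-strict
      (n + n) * (2 ^ v * E) * (1 + q) ^ b
        ≡⟨ l₁ n (2 ^ v) E ((1 + q) ^ b) ⟩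
      2 * 2 ^ v * n * (E * (1 + q) ^ b)
        ≡⟨ cong (2 * 2 ^ v * n *_) (expectedᴮ c) ⟩
      2 * 2 ^ v * n * ((2 + q) ^ b * (1 + q) ^ v)
        ≡⟨ l₂ (2 ^ v) n ((2 + q) ^ b) ((1 + q) ^ v) ⟩
      2 * 2 ^ v * (1 + q) ^ v * (n * (2 + q) ^ b)
        <⟨ ℕ.*-monoʳ-< (2 * 2 ^ v * (1 + q) ^ v) {{nz}} (B-small c) ⟩
      2 * 2 ^ v * (1 + q) ^ v * ((1 + q) ^ b * 2 ^ U)
        ≡⟨ l₃ (2 ^ v) ((1 + q) ^ v) ((1 + q) ^ b) (2 ^ U) ⟩
      (1 + q) ^ v * (2 * 2 ^ U * 2 ^ v) * (1 + q) ^ b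
        ≡⟨ cong (λ z → (1 + q) ^ v * z * (1 + q) ^ b) (2^ (suc U) v) ⟨
      suc q ^ v * 2 ^ (suc U + v) * (1 + q) ^ b ∎)
      where
      b = count (B? c)
      E = product (λ x → wᴮ c x true + q * wᴮ c x false)
      nz : NonZero (2 * 2 ^ v * (1 + q) ^ v)
      nz = ℕ.m*n≢0 _ _ {{ℕ.m^n≢0 2 (suc v)}} {{ℕ.m^n≢0 (1 + q) v}}
      l₁ : ∀ n a e d → (n + n) * (a * e) * d ≡ 2 * a * n * (e * d)
      l₁ = solve-∀
      l₂ : ∀ a n c d → 2 * a * n * (c * d) ≡ 2 * a * d * (n * c)
      l₂ = solve-∀
      l₃ : ∀ a b c d → 2 * a * b * (c * d) ≡ b * (2 * d * a) * c
      l₃ = solve-∀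

    bound : ∀ i → (n + n) * (u i * product (λ x → (wᴬ ++ wᴮ) i x true + q * (wᴬ ++ wᴮ) i x false))
                  < suc q ^ v * 2 ^ (suc U + v)
    bound i with splitAt n i
    ... | inj₁ c = boundᴬ c
    ... | inj₂ c = boundᴮ c

  sampled : Σ[ R ∈ (Fin v → Bool) ] (∀ c → t ≤ count (λ x → A? c x ×-dec T? (R x)) ×
                          count (λ x → B? c x ×-dec T? (R x)) ≤ U)
  sampled = R , λ c → ℕ.≮⇒≥ (lower c) , ℕ.≮⇒≥ (upper c)
    where
    derandomized = derandomize v q u (wᴬ ++ wᴮ)
    R = proj₁ derandomized
    potential : Fin (n + n) → ℕ
    potential i = u i * product (λ x → (wᴬ ++ wᴮ) i x (R x))

    potential< : ∀ i → potential i < 2 ^ (suc U + v)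
    potential< i = ℕ.≤-<-trans (term≤sum potential i)
      (ℕ.*-cancelˡ-< (suc q ^ v) _ _ (ℕ.≤-<-trans (proj₂ derandomized) (sum-< i _ bound)))

    lower : ∀ c → ¬ (count (λ x → A? c x ×-dec T? (R x)) < t)
    lower c a<t = ℕ.<⇒≱ (potential< (c ↑ˡ n)) (begin
      2 ^ (suc U + v)
        ≡⟨ 2^ (suc U) v ⟩
      2 ^ suc U * 2 ^ v
        ≡⟨ cong (2 ^ suc U *_) (trans (product-if A∩R? 1 2) (trans (cong (_* 2 ^ v) (ℕ.^-zeroˡ a)) (ℕ.*-identityˡ _))) ⟨
      2 ^ suc U * (product (λ x → wᴬ c x (R x)) * 2 ^ a)
        ≡⟨ l (2 ^ U) (product (λ x → wᴬ c x (R x))) (2 ^ a) ⟩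
      2 ^ U * 2 ^ suc a * product (λ x → wᴬ c x (R x))
        ≤⟨ ℕ.*-monoˡ-≤ _ (ℕ.*-monoʳ-≤ (2 ^ U) (ℕ.^-monoʳ-≤ 2 a<t)) ⟩
      2 ^ U * 2 ^ t * product (λ x → wᴬ c x (R x))
        ≡⟨ cong (_* product (λ x → wᴬ c x (R x))) (2^ U t) ⟨
      2 ^ (U + t) * product (λ x → wᴬ c x (R x))
        ≡⟨ cong₂ (λ y w → y * product (λ x → w x (R x))) (lookup-++ˡ _ (λ _ → 2 ^ v) c) (lookup-++ˡ wᴬ wᴮ c) ⟨
      potential (c ↑ˡ n) ∎)
      where
      A∩R? = λ x → A? c x ×-dec T? (R x)
      a = count A∩R?
      l : ∀ u p a → 2 * u * (p * a) ≡ u * (2 * a) * p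
      l = solve-∀

    upper : ∀ c → ¬ (U < count (λ x → B? c x ×-dec T? (R x)))
    upper c U<b = ℕ.<⇒≱ (potential< (n ↑ʳ c)) (begin
      2 ^ (suc U + v)
        ≤⟨ ℕ.^-monoʳ-≤ 2 (ℕ.+-monoˡ-≤ v U<b) ⟩
      2 ^ (b + v)
        ≡⟨ cong (2 ^_) (ℕ.+-comm b v) ⟩
      2 ^ (v + b)
        ≡⟨ 2^ v b ⟩
      2 ^ v * 2 ^ b
        ≡⟨ cong (2 ^ v *_) (trans (sym (ℕ.*-identityʳ _)) (trans (cong (2 ^ b *_) (sym (ℕ.^-zeroˡ v))) (sym (product-if B∩R? 2 1)))) ⟩
      2 ^ v * (product (λ x → wᴮ c x (R x)) * 1 ^ b)
        ≡⟨ cong (2 ^ v *_) (trans (cong (product (λ x → wᴮ c x (R x)) *_) (ℕ.^-zeroˡ b)) (ℕ.*-identityʳ _)) ⟩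
      2 ^ v * product (λ x → wᴮ c x (R x))
        ≡⟨ cong₂ (λ y w → y * product (λ x → w x (R x))) (lookup-++ʳ (λ (_ : Fin n) → 2 ^ (U + t)) (λ _ → 2 ^ v) c) (lookup-++ʳ wᴬ wᴮ c) ⟨
      potential (n ↑ʳ c) ∎)
      where
      B∩R? = λ x → B? c x ×-dec T? (R x)
      b = count B∩R?

-- Bernoulli inequalities and tail bounds

reverse-bernoulli : ∀ m j d → suc m ≡ j + d → suc m ^ j * d ≤ m ^ j * suc m
reverse-bernoulli m zero    d eq = ℕ.≤-reflexive (cong (_+ 0) (sym eq))
reverse-bernoulli m (suc j) d eq = begin
  suc m * suc m ^ j * d    ≡⟨ l (suc m) (suc m ^ j) d ⟩
  suc m ^ j * (suc m * d)  ≤⟨ ℕ.*-monoʳ-≤ (suc m ^ j) step ⟩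
  suc m ^ j * (m * suc d)  ≡⟨ l₁ (suc m ^ j) m (suc d) ⟩
  m * (suc m ^ j * suc d)  ≤⟨ ℕ.*-monoʳ-≤ m (reverse-bernoulli m j (suc d) (trans eq (sym (ℕ.+-suc j d)))) ⟩
  m * (m ^ j * suc m)      ≡⟨ ℕ.*-assoc m (m ^ j) (suc m) ⟨
  m * m ^ j * suc m        ∎
  where
  l : ∀ a b c → a * b * c ≡ b * (a * c)
  l = solve-∀
  l₁ : ∀ a b c → a * (b * c) ≡ b * (a * c)
  l₁ = solve-∀
  step : suc m * d ≤ m * suc d
  step = begin
    d + m * d  ≤⟨ ℕ.+-monoˡ-≤ (m * d) (ℕ.≤-trans (ℕ.m≤n+m d j) (ℕ.≤-reflexive (sym (ℕ.suc-injective eq)))) ⟩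
    m + m * d  ≡⟨ ℕ.*-suc m d ⟨
    m * suc d  ∎

bernoulli : ∀ m j → m ^ j * (m + j) ≤ m * suc m ^ j
bernoulli m zero    = ℕ.≤-reflexive (l m)
  where
  l : ∀ m → 1 * (m + 0) ≡ m * 1
  l = solve-∀
bernoulli m (suc j) = begin
  m * m ^ j * (m + suc j)    ≤⟨ ℕ.m≤m+n _ (m ^ j * j) ⟩
  m * m ^ j * (m + suc j) + m ^ j * j  ≡⟨ l m (m ^ j) j ⟩
  m ^ j * (m + j) * suc m    ≤⟨ ℕ.*-monoˡ-≤ (suc m) (bernoulli m j) ⟩
  m * suc m ^ j * suc m      ≡⟨ l₁ m (suc m ^ j) (suc m) ⟩
  m * (suc m * suc m ^ j)    ∎
  where
  l : ∀ m p j → m * p * (m + suc j) + p * j ≡ p * (m + j) * suc m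
  l = solve-∀
  l₁ : ∀ a b c → a * b * c ≡ a * (c * b)
  l₁ = solve-∀

-- Here 1 + q = 2r and M = 4r, so points are chosen with probability 1/(2r). Every `M` points at
-- least halve the mean of 2^-|A ∩ R|, and every `r` points at most double the mean of 2^|B ∩ R|.
module _ (r′ : ℕ) where
  private
    r = suc r′
    q = 1 + r′ * 2
    M = 2 + q * 2

  -- `reverse-bernoulli` is (1 - 1/(m+1))^j ≥ 1 - j/(m+1). At m = 2r and j = r it bounds (1 +
  -- 1/(2r))^r by (2r+1)/(r+1), which is below 2.
  growth-≤2 : (2 + q) ^ r ≤ 2 * (1 + q) ^ r
  growth-≤2 = ℕ.*-cancelʳ-≤ _ _ (suc r) (begin
    (2 + q) ^ r * suc r    ≤⟨ reverse-bernoulli (1 + q) r (suc r) (l r′) ⟩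
    (1 + q) ^ r * (2 + q)  ≤⟨ ℕ.*-monoʳ-≤ ((1 + q) ^ r) (ℕ.≤-trans (ℕ.n≤1+n _) (ℕ.≤-reflexive (l₁ r′))) ⟩
    (1 + q) ^ r * (2 * suc r)  ≡⟨ l₂ ((1 + q) ^ r) (suc r) ⟩
    2 * (1 + q) ^ r * suc r    ∎)
    where
    l : ∀ r′ → suc (1 + (1 + r′ * 2)) ≡ suc r′ + suc (suc r′)
    l = solve-∀
    l₁ : ∀ r′ → suc (2 + (1 + r′ * 2)) ≡ 2 * suc (suc r′)
    l₁ = solve-∀
    l₂ : ∀ a b → a * (2 * b) ≡ 2 * a * b
    l₂ = solve-∀

  growth-≥2 : 2 * (1 + q * 2) ^ M ≤ M ^ M
  growth-≥2 = begin
    2 * ((1 + q * 2) * m^m)          ≡⟨ l (1 + q * 2) m^m ⟩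
    m^m * (1 + q * 2 + (1 + q * 2))  ≤⟨ bernoulli (1 + q * 2) (1 + q * 2) ⟩
    (1 + q * 2) * M ^ (1 + q * 2)    ≤⟨ ℕ.m≤n+m ((1 + q * 2) * M ^ (1 + q * 2)) (M ^ (1 + q * 2)) ⟩
    M * M ^ (1 + q * 2)              ∎
    where
    m^m = (1 + q * 2) ^ (1 + q * 2)
    l : ∀ m p → 2 * (m * p) ≡ p * (m + m)
    l = solve-∀

  -- The `a` points contain t + w blocks of size `M`. Each block halves the mean: `w` of them absorb
  -- `n`, the other `t` absorb 2^t, and the remaining `e` points can only help.
  lower-tail : ∀ {n w} t a → n < 2 ^ w → M * (t + w) ≤ a → n * 2 ^ t * (1 + q * 2) ^ a < M ^ a
  lower-tail {n} {w} t a n<2^w z≤a = begin-strict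
    n * 2 ^ t * (1 + q * 2) ^ a
      <⟨ ℕ.*-monoˡ-< ((1 + q * 2) ^ a) {{ℕ.m^n≢0 (1 + q * 2) a}} (ℕ.*-monoˡ-< (2 ^ t) {{ℕ.m^n≢0 2 t}} n<2^w) ⟩
    2 ^ w * 2 ^ t * (1 + q * 2) ^ a
      ≡⟨ cong₂ _*_ (trans (ℕ.*-comm (2 ^ w) (2 ^ t)) (sym (ℕ.^-distribˡ-+-* 2 t w))) (cong ((1 + q * 2) ^_) a≡) ⟩
    2 ^ z * (1 + q * 2) ^ (M * z + e)
      ≡⟨ cong (2 ^ z *_) (ℕ.^-distribˡ-+-* (1 + q * 2) (M * z) e) ⟩
    2 ^ z * ((1 + q * 2) ^ (M * z) * (1 + q * 2) ^ e)
      ≡⟨ cong (λ y → 2 ^ z * (y * (1 + q * 2) ^ e)) (ℕ.^-*-assoc (1 + q * 2) M z) ⟨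
    2 ^ z * (((1 + q * 2) ^ M) ^ z * (1 + q * 2) ^ e)
      ≡⟨ ℕ.*-assoc (2 ^ z) _ _ ⟨
    2 ^ z * ((1 + q * 2) ^ M) ^ z * (1 + q * 2) ^ e
      ≡⟨ cong (_* (1 + q * 2) ^ e) (^-distribʳ-* z 2 ((1 + q * 2) ^ M)) ⟨
    (2 * (1 + q * 2) ^ M) ^ z * (1 + q * 2) ^ e
      ≤⟨ ℕ.*-mono-≤ (ℕ.^-monoˡ-≤ z growth-≥2) (ℕ.^-monoˡ-≤ e (ℕ.n≤1+n _)) ⟩
    (M ^ M) ^ z * M ^ e
      ≡⟨ cong (_* M ^ e) (ℕ.^-*-assoc M M z) ⟩
    M ^ (M * z) * M ^ e
      ≡⟨ ℕ.^-distribˡ-+-* M (M * z) e ⟨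
    M ^ (M * z + e)
      ≡⟨ cong (M ^_) a≡ ⟨
    M ^ a ∎
    where
    z = t + w
    e = a ∸ M * z
    a≡ : a ≡ M * z + e
    a≡ = sym (ℕ.m+[n∸m]≡n z≤a)

  -- Padding by `e` points makes exactly `y` blocks of size `r`, each at most doubling the mean; `n`
  -- costs a further 2^w.
  upper-tail : ∀ {n w y U} b → n < 2 ^ w → b ≤ r * y → y + w ≤ U →
          n * (2 + q) ^ b < (1 + q) ^ b * 2 ^ U
  upper-tail {n} {w} {y} {U} b n<2^w b≤ y+w≤U = begin-strict
    n * (2 + q) ^ b                ≤⟨ ℕ.*-monoʳ-≤ n ratio ⟩
    n * (2 ^ y * (1 + q) ^ b)      <⟨ ℕ.*-monoˡ-< (2 ^ y * (1 + q) ^ b) {{ℕ.m*n≢0 _ _ {{ℕ.m^n≢0 2 y}} {{ℕ.m^n≢0 (1 + q) b}}}} n<2^w ⟩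
    2 ^ w * (2 ^ y * (1 + q) ^ b)  ≡⟨ l (2 ^ w) (2 ^ y) ((1 + q) ^ b) ⟩
    (1 + q) ^ b * (2 ^ y * 2 ^ w)  ≡⟨ cong ((1 + q) ^ b *_) (ℕ.^-distribˡ-+-* 2 y w) ⟨
    (1 + q) ^ b * 2 ^ (y + w)      ≤⟨ ℕ.*-monoʳ-≤ ((1 + q) ^ b) (ℕ.^-monoʳ-≤ 2 y+w≤U) ⟩
    (1 + q) ^ b * 2 ^ U            ∎
    where
    l : ∀ a b c → a * (b * c) ≡ c * (b * a)
    l = solve-∀
    e = r * y ∸ b
    ≡ry : b + e ≡ r * y
    ≡ry = ℕ.m+[n∸m]≡n b≤
    ratio : (2 + q) ^ b ≤ 2 ^ y * (1 + q) ^ b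
    ratio = ℕ.*-cancelʳ-≤ _ _ ((1 + q) ^ e) {{ℕ.m^n≢0 (1 + q) e}} (begin
      (2 + q) ^ b * (1 + q) ^ e  ≤⟨ ℕ.*-monoʳ-≤ ((2 + q) ^ b) (ℕ.^-monoˡ-≤ e (ℕ.n≤1+n _)) ⟩
      (2 + q) ^ b * (2 + q) ^ e  ≡⟨ ℕ.^-distribˡ-+-* (2 + q) b e ⟨
      (2 + q) ^ (b + e)          ≡⟨ cong ((2 + q) ^_) ≡ry ⟩
      (2 + q) ^ (r * y)          ≡⟨ ℕ.^-*-assoc (2 + q) r y ⟨
      ((2 + q) ^ r) ^ y          ≤⟨ ℕ.^-monoˡ-≤ y growth-≤2 ⟩
      (2 * (1 + q) ^ r) ^ y      ≡⟨ ^-distribʳ-* y 2 ((1 + q) ^ r) ⟩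
      2 ^ y * ((1 + q) ^ r) ^ y  ≡⟨ cong (2 ^ y *_) (trans (ℕ.^-*-assoc (1 + q) r y) (cong ((1 + q) ^_) (sym ≡ry))) ⟩
      2 ^ y * (1 + q) ^ (b + e)  ≡⟨ cong (2 ^ y *_) (ℕ.^-distribˡ-+-* (1 + q) b e) ⟩
      2 ^ y * ((1 + q) ^ b * (1 + q) ^ e)  ≡⟨ ℕ.*-assoc (2 ^ y) _ _ ⟨
      2 ^ y * (1 + q) ^ b * (1 + q) ^ e    ∎)

  sample : ∀ {n v w y U} t {A B : Fin n → Fin v → Set}
           (A? : ∀ c → Decidable (A c)) (B? : ∀ c → Decidable (B c)) →
           n < 2 ^ w → y + w ≤ U →
           (∀ c → M * (t + w) ≤ count (A? c)) → (∀ c → count (B? c) ≤ r * y) →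
           Σ[ R ∈ (Fin v → Bool) ] (∀ c → t ≤ count (λ x → A? c x ×-dec T? (R x)) ×
                                          count (λ x → B? c x ×-dec T? (R x)) ≤ U)
  sample {w = w} {y} {U} t A? B? n<2^w y+w≤U A-large B-small =
    sampled A? B? q t U (λ c → lower-tail t (count (A? c)) n<2^w (A-large c))
                        (λ c → upper-tail {y = y} (count (B? c)) n<2^w (B-small c) y+w≤U)

-- Nearly full rainbow matchings

-- Row c lists one end of each of N edges of colour c; a graph is a pair of arrays L, R.
Array : ℕ → ℕ → ℕ → Set
Array n N v = Fin n → Fin N → Fin v

RowInjective : Array n N v → Set
RowInjective E = ∀ c {i j} → E c i ≡ E c j → i ≡ j

-- At most one edge for each colour, so rainbowness is built in; being a matching is `Disjoint` for
-- `L` and for `R`.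
Partial : ℕ → ℕ → Set
Partial n N = Fin n → Maybe (Fin N)

Covers : Array n N v → Partial n N → Fin v → Set
Covers E g a = ∃[ c ] ∃[ j ] (g c ≡ just j × E c j ≡ a)

Disjoint : Array n N v → Partial n N → Set
Disjoint E g = ∀ {c d i j} → g c ≡ just i → g d ≡ just j → E c i ≡ E d j → c ≡ d

_≟ᴹ_ : (x y : Maybe (Fin N)) → Dec (x ≡ y)
_≟ᴹ_ = Maybe-≡-dec Fin._≟_

covers? : (E : Array n N v) (g : Partial n N) → Decidable (Covers E g)
covers? E g a = Fin.any? λ c → Fin.any? λ j → (g c ≟ᴹ just j) ×-dec (E c j Fin.≟ a)

missing? : (g : Partial n N) → Decidable (λ c → g c ≡ nothing)
missing? g c = g c ≟ᴹ nothing

#missing : Partial n N → ℕ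
#missing g = count (missing? g)

_[_]≔_ : Partial n N → Fin n → Maybe (Fin N) → Partial n N
g [ c ]≔ x = updateAt g c (const x)

lookup-updated : (g : Partial n N) (c : Fin n) {x : Maybe (Fin N)} → (g [ c ]≔ x) c ≡ x
lookup-updated g c = updateAt-updates c g

lookup-other : (g : Partial n N) {c d : Fin n} {x : Maybe (Fin N)} → d ≢ c → (g [ c ]≔ x) d ≡ g d
lookup-other g {c} {d} d≢c = updateAt-minimal d c g d≢c

≡nothing⇒≢just : {x : Maybe (Fin N)} {j : Fin N} → x ≡ nothing → x ≢ just j
≡nothing⇒≢just refl ()

module _ (g : Partial n N) (c : Fin n) where

  removed⇒≢ : ∀ {d i} → (g [ c ]≔ nothing) d ≡ just i → d ≢ c
  removed⇒≢ eq refl = ≡nothing⇒≢just (lookup-updated g c) eq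

  removed⇒original : ∀ {d i} → (g [ c ]≔ nothing) d ≡ just i → g d ≡ just i
  removed⇒original eq = trans (sym (lookup-other g (removed⇒≢ eq))) eq

  inserted⇒original : ∀ {j d i} → (g [ c ]≔ just j) d ≡ just i → (d ≡ c × i ≡ j) ⊎ (d ≢ c × g d ≡ just i)
  inserted⇒original {j} {d} eq with d Fin.≟ c
  ... | yes refl = inj₁ (refl , just-injective (trans (sym eq) (lookup-updated g c)))
  ... | no  d≢c  = inj₂ (d≢c , trans (sym (lookup-other g d≢c)) eq)

  disjoint-remove : {E : Array n N v} → Disjoint E g → Disjoint E (g [ c ]≔ nothing)
  disjoint-remove disj eq eq′ = disj (removed⇒original eq) (removed⇒original eq′)

  disjoint-insert : {E : Array n N v} {j : Fin N} → Disjoint E g → ¬ Covers E g (E c j) →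
                    Disjoint E (g [ c ]≔ just j)
  disjoint-insert {j = j} disj ¬cov eq eq′ E≡ with inserted⇒original {j} eq | inserted⇒original {j} eq′
  ... | inj₁ (refl , refl) | inj₁ (refl , refl) = refl
  ... | inj₁ (refl , refl) | inj₂ (_ , old)     = ⊥-elim (¬cov (_ , _ , old , sym E≡))
  ... | inj₂ (_ , old)     | inj₁ (refl , refl) = ⊥-elim (¬cov (_ , _ , old , E≡))
  ... | inj₂ (_ , old)     | inj₂ (_ , old′)    = disj old old′ E≡

  covers-remove : {E : Array n N v} {a : Fin v} → Covers E (g [ c ]≔ nothing) a → Covers E g a
  covers-remove (d , i , eq , E≡) = d , i , removed⇒original eq , E≡

  covers-insert : {E : Array n N v} {j : Fin N} {a : Fin v} → Covers E (g [ c ]≔ just j) a →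
                  E c j ≡ a ⊎ Covers E g a
  covers-insert {j = j} (d , i , eq , E≡) with inserted⇒original {j} eq
  ... | inj₁ (refl , refl) = inj₁ E≡
  ... | inj₂ (_ , old)     = inj₂ (d , i , old , E≡)

  freed-by-removal : {E : Array n N v} {i : Fin N} → Disjoint E g → g c ≡ just i →
                     ¬ Covers E (g [ c ]≔ nothing) (E c i)
  freed-by-removal disj gc (d , j , eq , E≡) = removed⇒≢ eq (disj (removed⇒original eq) gc E≡)

  #missing-remove : #missing (g [ c ]≔ nothing) ≤ suc (#missing g)
  #missing-remove = ℕ.≤-trans
    (count-∪ (missing? (g [ c ]≔ nothing)) (Fin._≟ c) (missing? g) cases)
    (ℕ.+-monoˡ-≤ (#missing g) (count-singleton c))
    where
    cases : ∀ d → _ → _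
    cases d eq with d Fin.≟ c
    ... | yes d≡c = inj₁ d≡c
    ... | no  d≢c = inj₂ (trans (sym (lookup-other g d≢c)) eq)

  #missing-insert : ∀ {j} → g c ≡ nothing → #missing (g [ c ]≔ just j) < #missing g
  #missing-insert {j} gc = count-⊂ (missing? (g [ c ]≔ just j)) (missing? g) still
    (λ eq → ≡nothing⇒≢just eq (lookup-updated g c)) gc
    where
    still : ∀ d → _ → _
    still d eq with d Fin.≟ c
    ... | yes refl = gc
    ... | no  d≢c  = trans (sym (lookup-other g d≢c)) eq

-- Augmenting along alternating paths

module Augment (L R : Array n N v) (L-inj : RowInjective L) (R-inj : RowInjective R) (g : Partial n N) where

  Augmented : Set
  Augmented = ∃[ h ] (Disjoint L h × Disjoint R h × #missing h < #missing g)

  -- An alternating path from an uncovered left vertex to a, already flipped: it has used up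
  -- some missing colours but none of the ι i, and changed matching edges only in the colours S.
  record Rerouting (ι : Fin k → Fin n) (S : Fin n → Set) (a : Fin v) : Set where
    field
      matching  : Partial n N
      disjointL : Disjoint L matching
      disjointR : Disjoint R matching
      #missing≤ : #missing matching ≤ #missing g
      agrees    : ∀ {d j} → g d ≡ just j → ¬ S d → matching d ≡ just j
      spare     : ∀ i → matching (ι i) ≡ nothing
      avoids    : ¬ Covers L matching a
      covers⊆   : ∀ {b} → Covers R matching b → Covers R g b

  open Rerouting

  module _ (disjL : Disjoint L g) (disjR : Disjoint R g) where

    -- `S` collects the colours whose matching edge can release its left end without increasing the
    -- number of missing colours and without spending any `ι i`.
    Reachable : (Fin k → Fin n) → (Fin n → Set) → Set
    Reachable ι S = ∀ c → S c → ∃[ j ] (g c ≡ just j × Rerouting ι S (L c j))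

    -- A layer spends the missing colour `m`. An unblocked edge of `m` can have its left end freed.
    -- If its right end is uncovered, it augments; otherwise the matching edge at that right end can
    -- be exchanged for it, which makes one more colour reachable.
    module Layer (ι : Fin (suc k) → Fin n) (ι-inj : ∀ {i j} → ι i ≡ ι j → i ≡ j)
                 (ι-missing : ∀ i → g (ι i) ≡ nothing)
                 {S : Fin n → Set} (S? : Decidable S) (reach : Reachable ι S) where

      m = ι zero

      Blocked : Fin N → Set
      Blocked j = ∃[ c ] (¬ S c × ∃[ i ] (g c ≡ just i × L c i ≡ L m j))

      blocked? : Decidable Blocked
      blocked? j = Fin.any? λ c → ¬? (S? c) ×-dec Fin.any? λ i → (g c ≟ᴹ just i) ×-dec (L c i Fin.≟ L m j)

      reroute : ∀ j → ¬ Blocked j → Rerouting ι S (L m j)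
      reroute j ¬blocked with covers? L g (L m j)
      ... | no ¬covered = record
        { matching = g ; disjointL = disjL ; disjointR = disjR ; #missing≤ = ℕ.≤-refl
        ; agrees = λ eq _ → eq ; spare = ι-missing ; avoids = ¬covered ; covers⊆ = λ cov → cov }
      ... | yes (c , i , gc , L≡) with S? c
      ...   | no ¬s = ⊥-elim (¬blocked (c , ¬s , i , gc , L≡))
      ...   | yes s with reach c s
      ...     | i′ , gc′ , ρ with just-injective (trans (sym gc) gc′)
      ...       | refl = subst (Rerouting ι S) L≡ ρ

      augment : ∀ j → ¬ Blocked j → ¬ Covers R g (R m j) → Augmented
      augment j ¬blocked ¬covered =
        matching ρ [ m ]≔ just j ,
        disjoint-insert (matching ρ) m (disjointL ρ) (avoids ρ) ,
        disjoint-insert (matching ρ) m (disjointR ρ) (¬covered ∘ covers⊆ ρ) ,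
        ℕ.<-≤-trans (#missing-insert (matching ρ) m (spare ρ zero)) (#missing≤ ρ)
        where ρ = reroute j ¬blocked

      Hit : Fin n → Set
      Hit c = ∃[ i ] (g c ≡ just i × ∃[ j ] (¬ Blocked j × R c i ≡ R m j))

      hit? : Decidable Hit
      hit? c = Fin.any? λ i → (g c ≟ᴹ just i) ×-dec Fin.any? λ j → ¬? (blocked? j) ×-dec (R c i Fin.≟ R m j)

      S′ : Fin n → Set
      S′ c = S c ⊎ Hit c

      S′? : Decidable S′
      S′? c = S? c ⊎-dec hit? c

      reach′ : Reachable (ι ∘ suc) S′
      reach′ c s′ with S? c
      ... | yes s = let i , gc , ρ = reach c s in i , gc , record
        { matching = matching ρ ; disjointL = disjointL ρ ; disjointR = disjointR ρ ; #missing≤ = #missing≤ ρ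
        ; agrees = λ eq ¬s′ → agrees ρ eq (¬s′ ∘ inj₁) ; spare = spare ρ ∘ suc
        ; avoids = avoids ρ ; covers⊆ = covers⊆ ρ }
      ... | no ¬s with s′
      ...   | inj₁ s = ⊥-elim (¬s s)
      -- The flip: edge `j` of colour `m` replaces edge `i` of colour `c`. They share their right
      -- end, so no new right vertex is covered, while the left end of `i` becomes free.
      ...   | inj₂ (i , gc , j , ¬blocked , R≡) = i , gc , record
        { matching  = h₁
        ; disjointL = disjoint-insert h₀ m (disjoint-remove h c (disjointL ρ)) (avoids ρ ∘ covers-remove h c)
        ; disjointR = disjoint-insert h₀ m (disjoint-remove h c (disjointR ρ))
                        (subst (¬_ ∘ Covers R h₀) R≡ (freed-by-removal h c (disjointR ρ) hc))
        ; #missing≤ = ℕ.≤-trans (s≤s⁻¹ (ℕ.<-≤-trans (#missing-insert h₀ m h₀m) (#missing-remove h c))) (#missing≤ ρ)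
        ; agrees    = agrees′
        ; spare     = spare′
        ; avoids    = avoids′
        ; covers⊆   = covers′
        }
        where
        ρ = reroute j ¬blocked
        h = matching ρ
        h₀ = h [ c ]≔ nothing
        h₁ = h₀ [ m ]≔ just j
        -- As `c` is outside `S`, the earlier flips left its edge in place.
        hc : h c ≡ just i
        hc = agrees ρ gc ¬s
        m≢c : m ≢ c
        m≢c refl = ≡nothing⇒≢just (ι-missing zero) gc
        h₀m : h₀ m ≡ nothing
        h₀m = trans (lookup-other h m≢c) (spare ρ zero)
        agrees′ : ∀ {d j} → g d ≡ just j → ¬ S′ d → h₁ d ≡ just j
        agrees′ {d} gd ¬s′ = trans (lookup-other h₀ d≢m) (trans (lookup-other h d≢c) (agrees ρ gd (¬s′ ∘ inj₁)))
          where
          d≢m : d ≢ m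
          d≢m refl = ≡nothing⇒≢just (ι-missing zero) gd
          d≢c : d ≢ c
          d≢c refl = ¬s′ s′
        spare′ : ∀ i → h₁ (ι (suc i)) ≡ nothing
        spare′ i = trans (lookup-other h₀ (λ eq → Fin.0≢1+n (sym (ι-inj eq))))
                     (trans (lookup-other h (λ { refl → ≡nothing⇒≢just (ι-missing (suc i)) gc })) (spare ρ (suc i)))
        avoids′ : ¬ Covers L h₁ (L c i)
        avoids′ cov with covers-insert h₀ m cov
        ... | inj₁ L≡   = avoids ρ (c , i , hc , sym L≡)
        ... | inj₂ cov₀ = freed-by-removal h c (disjointL ρ) hc cov₀
        covers′ : ∀ {b} → Covers R h₁ b → Covers R g b
        covers′ cov with covers-insert h₀ m cov
        ... | inj₁ R≡b  = c , i , gc , trans R≡ R≡b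
        ... | inj₂ cov₀ = covers⊆ ρ (covers-remove h c cov₀)

      -- Edges of `m` have distinct ends. Hence the blocked ones have different blocking colours
      -- outside `S`, at most n - |S| of them, and the others meet different colours of `S′` on the
      -- right, at least N - n + |S| of them.
      grow : ∀ {x} → n + x ≤ N → (∀ j → ¬ Blocked j → Covers R g (R m j)) → x + count S? ≤ count S′?
      grow {x} n+x≤N all-covered = ℕ.+-cancelˡ-≤ (count (¬? ∘ S?)) _ _ (begin
        count (¬? ∘ S?) + (x + count S?)           ≡⟨ lemma (count (¬? ∘ S?)) x (count S?) ⟩
        count S? + count (¬? ∘ S?) + x             ≡⟨ cong (_+ x) (count-∁ S?) ⟩
        n + x                                      ≤⟨ n+x≤N ⟩
        N                                          ≡⟨ count-∁ blocked? ⟨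
        count blocked? + count (¬? ∘ blocked?)     ≤⟨ ℕ.+-mono-≤ blocked≤ unblocked≤ ⟩
        count (¬? ∘ S?) + count S′?                ∎)
        where
        lemma : ∀ a b c → a + (b + c) ≡ c + a + b
        lemma = solve-∀
        blocked≤ : count blocked? ≤ count (¬? ∘ S?)
        blocked≤ = count-↣ blocked? (¬? ∘ S?) (λ j c → ∃[ i ] (g c ≡ just i × L c i ≡ L m j))
          (λ { j (c , ¬s , rest) → c , ¬s , rest })
          (λ { (i , gc , eq) (i′ , gc′ , eq′) → L-inj m
            (trans (sym eq) (trans (cong (L _) (just-injective (trans (sym gc) gc′))) eq′)) })
        unblocked≤ : count (¬? ∘ blocked?) ≤ count S′?
        unblocked≤ = count-↣ (¬? ∘ blocked?) S′? (λ j c → ∃[ i ] (g c ≡ just i × R c i ≡ R m j))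
          (λ j ¬b → let c , i , gc , R≡ = all-covered j ¬b in c , inj₂ (i , gc , j , ¬b , R≡) , i , gc , R≡)
          (λ { (i , gc , eq) (i′ , gc′ , eq′) → R-inj m
            (trans (sym eq) (trans (cong (R _) (just-injective (trans (sym gc) gc′))) eq′)) })

    -- If no layer augments, every missing colour spent adds at least `x` colours to `S`, which can
    -- never hold more than `n`.
    layers : ∀ {k x} → n + x ≤ N → (ι : Fin k → Fin n) → (∀ {i j} → ι i ≡ ι j → i ≡ j) →
             (∀ i → g (ι i) ≡ nothing) → {S : Fin n → Set} (S? : Decidable S) → Reachable ι S →
             Augmented ⊎ k * x + count S? ≤ n
    layers {zero}  _ ι ι-inj ι-missing S? reach = inj₂ (count≤n S?)
    layers {suc k} {x} n+x≤N ι ι-inj ι-missing S? reach =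
      search (Fin.any? λ j → ¬? (blocked? j) ×-dec ¬? (covers? R g (R m j)))
      where
      open Layer ι ι-inj ι-missing S? reach
      search : Dec (∃[ j ] (¬ Blocked j × ¬ Covers R g (R m j))) → Augmented ⊎ suc k * x + count S? ≤ n
      search (yes (j , ¬b , ¬cov)) = inj₁ (augment j ¬b ¬cov)
      search (no none) with layers n+x≤N (ι ∘ suc) (Fin.suc-injective ∘ ι-inj) (ι-missing ∘ suc) S′? reach′
      ... | inj₁ aug = inj₁ aug
      ... | inj₂ le  = inj₂ (begin
        x + k * x + count S?    ≡⟨ lemma x (k * x) (count S?) ⟩
        k * x + (x + count S?)  ≤⟨ ℕ.+-monoʳ-≤ (k * x) (grow n+x≤N covered) ⟩
        k * x + count S′?       ≤⟨ le ⟩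
        n                       ∎)
        where
        lemma : ∀ a b c → a + b + c ≡ b + (a + c)
        lemma = solve-∀
        covered : ∀ j → ¬ Blocked j → Covers R g (R m j)
        covered j ¬b with covers? R g (R m j)
        ... | yes cov = cov
        ... | no ¬cov = ⊥-elim (none (j , ¬b , ¬cov))

    augment-or-few-missing : ∀ {x} → n + x ≤ N → Augmented ⊎ #missing g * x ≤ n
    augment-or-few-missing n+x≤N
      with layers n+x≤N (element (missing? g)) (element-injective (missing? g)) (element-satisfies (missing? g))
                  {λ _ → ⊥} (λ _ → no λ ()) (λ _ ())
    ... | inj₁ aug = inj₁ aug
    ... | inj₂ le  = inj₂ (ℕ.≤-trans (ℕ.m≤m+n _ _) le)

abstract
  nearly-full-matching : (L R : Array n N v) → RowInjective L → RowInjective R → ∀ {x} → n + x ≤ N →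
    ∃[ g ] (Disjoint L g × Disjoint R g × #missing g * x ≤ n)
  nearly-full-matching {n} {N} L R L-inj R-inj {x} n+x≤N = improve n (const nothing) (count≤n _) (λ ()) (λ ())
    where
    improve : ∀ fuel g → #missing g ≤ fuel → Disjoint L g → Disjoint R g →
              ∃[ h ] (Disjoint L h × Disjoint R h × #missing h * x ≤ n)
    improve fuel g g≤fuel disjL disjR
      with Augment.augment-or-few-missing L R L-inj R-inj g disjL disjR n+x≤N
    improve fuel       g g≤fuel disjL disjR | inj₂ few = g , disjL , disjR , few
    improve zero       g g≤fuel disjL disjR | inj₁ (h , _ , _ , h<g) = ⊥-elim (ℕ.n≮0 (ℕ.<-≤-trans h<g g≤fuel))
    improve (suc fuel) g g≤fuel disjL disjR | inj₁ (h , hL , hR , h<g) =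
      improve fuel h (s≤s⁻¹ (ℕ.<-≤-trans h<g g≤fuel)) hL hR

-- Reserving and completing

all? : Decidable {A = Fin n} (λ _ → ⊤)
all? _ = yes tt

count-all : n ≤ count (all? {n})
count-all = injection⇒≤count all? (λ i → i) (λ eq → eq) (λ _ → tt)

-- Sampling acts on vertices, whereas the sizes needed count edges. Images translate between the
-- two, without loss when the ends are distinct.
module _ {D : Fin N → Set} (D? : Decidable D) (e : Fin N → Fin v) where

  Image : Fin v → Set
  Image a = ∃[ j ] (D j × e j ≡ a)

  image? : Decidable Image
  image? a = Fin.any? λ j → D? j ×-dec (e j Fin.≟ a)

  count-image≤ : count image? ≤ N
  count-image≤ = ℕ.≤-trans
    (count-↣ image? all? (λ a j → e j ≡ a)
      (λ { a (j , _ , eq) → j , tt , eq }) (λ p q → trans (sym p) q))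
    (count≤n _)

  count-image∩≤ : {Q : Fin v → Set} (Q? : Decidable Q) →
    count (λ a → image? a ×-dec Q? a) ≤ count (λ j → D? j ×-dec Q? (e j))
  count-image∩≤ Q? = count-↣ (λ a → image? a ×-dec Q? a) (λ j → D? j ×-dec Q? (e j)) (λ a j → e j ≡ a)
    (λ { a ((j , d , refl) , q) → j , (d , q) , refl }) (λ p q → trans (sym p) q)

  module _ (e-inj : ∀ {i j} → e i ≡ e j → i ≡ j) where

    count≤count-image : count D? ≤ count image?
    count≤count-image = count-↣ D? image? (λ j a → e j ≡ a)
      (λ j d → e j , (j , d , refl) , refl) (λ p q → e-inj (trans p (sym q)))

    count≤count-image∩ : {Q : Fin v → Set} (Q? : Decidable Q) →
      count (λ j → D? j ×-dec Q? (e j)) ≤ count (λ a → image? a ×-dec Q? a)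
    count≤count-image∩ Q? = count-↣ (λ j → D? j ×-dec Q? (e j)) (λ a → image? a ×-dec Q? a) (λ j a → e j ≡ a)
      (λ { j (d , q) → e j , ((j , d , refl) , q) , refl }) (λ p q → e-inj (trans p (sym q)))

abstract
  -- The lower bound is relative to `D` so that the second reserve can be drawn inside the edges
  -- kept by the first; the upper bound concerns all edges.
  reserve : (E : Array n N v) → RowInjective E → ∀ r′ {w y U} t →
    n < 2 ^ w → y + w ≤ U → N ≤ suc r′ * y →
    {D : Fin n → Fin N → Set} (D? : ∀ c → Decidable (D c)) →
    (∀ c → (2 + (1 + r′ * 2) * 2) * (t + w) ≤ count (D? c)) →
    Σ[ R ∈ (Fin v → Bool) ] (∀ c → t ≤ count (λ j → D? c j ×-dec T? (R (E c j))) ×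
                                   count (λ j → T? (R (E c j))) ≤ U)
  reserve E E-inj r′ t n<2^w y+w≤U N≤ry D? D-large =
    let R , R-good = sample r′ t (λ c → image? (D? c) (E c)) (λ c → image? all? (E c)) n<2^w y+w≤U
          (λ c → ℕ.≤-trans (D-large c) (count≤count-image (D? c) (E c) (E-inj c)))
          (λ c → ℕ.≤-trans (count-image≤ all? (E c)) N≤ry)
    in R , λ c →
      ℕ.≤-trans (proj₁ (R-good c)) (count-image∩≤ (D? c) (E c) (λ a → T? (R a))) ,
      ℕ.≤-trans (count-⊆ (λ j → T? (R (E c j))) (λ j → all? j ×-dec T? (R (E c j))) (λ _ q → tt , q))
        (ℕ.≤-trans (count≤count-image∩ all? (E c) (E-inj c) (λ a → T? (R a))) (proj₂ (R-good c)))

Transversal : Array n N v → Array n N v → Set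
Transversal {n} {N} L R = Σ[ h ∈ (Fin n → Fin N) ]
  ((∀ {c d} → L c (h c) ≡ L d (h d) → c ≡ d) × (∀ {c d} → R c (h c) ≡ R d (h d) → c ≡ d))

-- F contains the colours missing at the start; no other colour ever uses a reserved vertex,
-- so at most 2 ∣F∣ reserved edges of a colour are blocked at any time.
module Completion (L R : Array n N v) (L-inj : RowInjective L) (R-inj : RowInjective R)
  (P Q : Fin v → Bool) {F : Fin n → Set} (F? : Decidable F) {t : ℕ} (2f<t : count F? + count F? < t)
  (reserved : ∀ c → t ≤ count (λ j → T? (P (L c j)) ×-dec T? (Q (R c j)))) where

  -- A reserved vertex is covered by a colour of `F` only, and distinct edges of `c` have distinct
  -- ends, so each blocked edge is charged to its own colour of `F`.
  blocked-few : (E : Array n N v) → RowInjective E → (g : Partial n N) (S : Fin v → Bool) →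
    (∀ {d i} → g d ≡ just i → T (S (E d i)) → F d) → ∀ c →
    count (λ j → T? (S (E c j)) ×-dec covers? E g (E c j)) ≤ count F?
  blocked-few E E-inj g S g∩S⇒F c = count-↣ (λ j → T? (S (E c j)) ×-dec covers? E g (E c j)) F? (λ j d → ∃[ i ] (g d ≡ just i × E d i ≡ E c j))
    (λ { j (s , d , i , gd , E≡) → d , g∩S⇒F gd (subst (T ∘ S) (sym E≡) s) , i , gd , E≡ })
    (λ { (i , gd , eq) (i′ , gd′ , eq′) → E-inj c
      (trans (sym eq) (trans (cong (E _) (just-injective (trans (sym gd) gd′))) eq′)) })

  complete : ∀ fuel (g : Partial n N) → #missing g ≤ fuel → Disjoint L g → Disjoint R g →
    (∀ {d} → g d ≡ nothing → F d) →
    (∀ {d i} → g d ≡ just i → T (P (L d i)) → F d) →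
    (∀ {d i} → g d ≡ just i → T (Q (R d i)) → F d) →
    Transversal L R
  complete fuel g g≤fuel disjL disjR missing⊆F P⊆F Q⊆F with Fin.any? (missing? g)
  ... | no full = h , (λ {c} {d} → disjL (gh c) (gh d)) , λ {c} {d} → disjR (gh c) (gh d)
    where
    total : ∀ c → ∃[ j ] g c ≡ just j
    total c with g c in gc
    ... | just j  = j , refl
    ... | nothing = ⊥-elim (full (c , gc))
    h  = λ c → proj₁ (total c)
    gh = λ c → proj₂ (total c)
  complete zero g g≤0 disjL disjR missing⊆F P⊆F Q⊆F | yes (c , gc) =
    ⊥-elim (Fin.¬Fin0 (subst Fin (ℕ.n≤0⇒n≡0 g≤0) (index (missing? g) c gc)))
  complete (suc fuel) g g≤fuel disjL disjR missing⊆F P⊆F Q⊆F | yes (c , gc) =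
    let j , (p , q) , ¬blockedL , ¬blockedR = free
    in complete fuel (g [ c ]≔ just j)
         (s≤s⁻¹ (ℕ.<-≤-trans (#missing-insert g c gc) g≤fuel))
         (disjoint-insert g c disjL (λ cov → ¬blockedL (p , cov)))
         (disjoint-insert g c disjR (λ cov → ¬blockedR (q , cov)))
         (still-missing j) (still-in j P⊆F) (still-in j Q⊆F)
    where
    free = count-excess (λ j → T? (P (L c j)) ×-dec T? (Q (R c j)))
      (λ j → T? (P (L c j)) ×-dec covers? L g (L c j))
      (λ j → T? (Q (R c j)) ×-dec covers? R g (R c j))
      (ℕ.≤-<-trans (ℕ.+-mono-≤ (blocked-few L L-inj g P P⊆F c) (blocked-few R R-inj g Q Q⊆F c))
        (ℕ.<-≤-trans 2f<t (reserved c)))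
    still-missing : ∀ j {d} → (g [ c ]≔ just j) d ≡ nothing → F d
    still-missing j {d} eq with d Fin.≟ c
    ... | yes refl = missing⊆F gc
    ... | no  d≢c  = missing⊆F (trans (sym (lookup-other g d≢c)) eq)
    still-in : ∀ j {S : Fin n → Fin N → Set} → (∀ {d i} → g d ≡ just i → S d i → F d) →
               ∀ {d i} → (g [ c ]≔ just j) d ≡ just i → S d i → F d
    still-in j S⊆F eq s with inserted⇒original g c {j} eq
    ... | inj₁ (refl , _) = missing⊆F gc
    ... | inj₂ (_ , old)  = S⊆F old s

module _ (L R : Array n N v) (L-inj : RowInjective L) (R-inj : RowInjective R)
  (P Q : Fin v → Bool) {x t U : ℕ} (n+x+2U≤N : n + x + (U + U) ≤ N)
  (P-small : ∀ c → count (λ j → T? (P (L c j))) ≤ U)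
  (Q-small : ∀ c → count (λ j → T? (Q (R c j))) ≤ U)
  (few : ∀ k → k * x ≤ n → k + k < t)
  (reserved : ∀ c → t ≤ count (λ j → T? (P (L c j)) ×-dec T? (Q (R c j)))) where

  private
    Outside : Fin n → Fin N → Set
    Outside c j = ¬ (T (P (L c j)) ⊎ T (Q (R c j)))

    touching? : ∀ c → Decidable (λ j → T (P (L c j)) ⊎ T (Q (R c j)))
    touching? c j = T? (P (L c j)) ⊎-dec T? (Q (R c j))

    outside? : ∀ c → Decidable (Outside c)
    outside? c j = ¬? (touching? c j)

    outside-many : ∀ c → n + x ≤ count (outside? c)
    outside-many c = ℕ.+-cancelˡ-≤ (U + U) _ _ (begin
      U + U + (n + x)                            ≡⟨ ℕ.+-comm (U + U) (n + x) ⟩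
      n + x + (U + U)                            ≤⟨ n+x+2U≤N ⟩
      N                                          ≡⟨ count-∁ (touching? c) ⟨
      count (touching? c) + count (outside? c)   ≤⟨ ℕ.+-monoˡ-≤ _ (ℕ.≤-trans
        (count-∪ (touching? c) (λ j → T? (P (L c j))) (λ j → T? (Q (R c j))) (λ _ s → s))
        (ℕ.+-mono-≤ (P-small c) (Q-small c))) ⟩
      U + U + count (outside? c)                 ∎)

    -- The path argument wants rows of equal length, so exactly `n + x` outside edges of each colour
    -- are kept.
    e : Fin n → Fin (n + x) → Fin N
    e c i = element (outside? c) (inject≤ i (outside-many c))

    e-inj : ∀ c {i j} → e c i ≡ e c j → i ≡ j
    e-inj c eq = Fin.inject≤-injective (outside-many c) (outside-many c) _ _
      (element-injective (outside? c) eq)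

    e-outside : ∀ c i → Outside c (e c i)
    e-outside c i = element-satisfies (outside? c) _

    partial = nearly-full-matching (λ c i → L c (e c i)) (λ c i → R c (e c i))
      (λ c eq → e-inj c (L-inj c eq)) (λ c eq → e-inj c (R-inj c eq)) {x} ℕ.≤-refl

    g₀ = proj₁ partial

    g : Partial n N
    g c = Maybe.map (e c) (g₀ c)

    g-just : ∀ {c j} → g c ≡ just j → ∃[ i ] (g₀ c ≡ just i × e c i ≡ j)
    g-just {c} eq with g₀ c
    g-just refl | just i = i , refl , refl

    g-nothing : ∀ {c} → g c ≡ nothing → g₀ c ≡ nothing
    g-nothing {c} eq with g₀ c
    ... | nothing = refl

    g-disjoint : (E : Array n N v) → Disjoint (λ c i → E c (e c i)) g₀ → Disjoint E g
    g-disjoint E disj gc gd E≡ with g-just gc | g-just gd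
    ... | _ , g₀c , refl | _ , g₀d , refl = disj g₀c g₀d E≡

    g-outside : ∀ {c j} → g c ≡ just j → Outside c j
    g-outside {c} gc with g-just gc
    ... | i , _ , refl = e-outside c i

  transversal-from-reserves : Transversal L R
  transversal-from-reserves = Completion.complete L R L-inj R-inj P Q (missing? g₀) (few (#missing g₀) (proj₂ (proj₂ (proj₂ partial)))) reserved
    n g (count≤n (missing? g)) (g-disjoint L (proj₁ (proj₂ partial))) (g-disjoint R (proj₁ (proj₂ (proj₂ partial))))
    g-nothing
    (λ gc p → ⊥-elim (g-outside gc (inj₁ p)))
    (λ gc q → ⊥-elim (g-outside gc (inj₂ q)))

transversal : ∀ r′ {w x} → let M = 2 + (1 + r′ * 2) * 2 in
  (L R : Array n (M * x) v) → RowInjective L → RowInjective R →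
  n < 2 ^ w → M * (suc (M + M) + w) + w ≤ x → n + 11 * x ≤ M * x → Transversal L R
transversal {n} r′ {w} {x} L R L-inj R-inj n<2^w x-large n+11x≤Mx =
  transversal-from-reserves L R L-inj R-inj P Q {x} {t} {U} room
    (proj₂ ∘ P-good) (proj₂ ∘ Q-good) few
    (λ c → ℕ.≤-trans (proj₁ (Q-good c)) (count-⊆ (λ j → (all? j ×-dec T? (P (L c j))) ×-dec T? (Q (R c j))) (λ j → T? (P (L c j)) ×-dec T? (Q (R c j)))
      (λ { j ((_ , p) , q) → p , q })))
  where
  M = 2 + (1 + r′ * 2) * 2
  -- Since n ≤ M x, at most `M` colours stay missing, whatever `n` is; `t` must exceed twice that.
  t = suc (M + M)
  -- What the second draw demands of each colour, hence the target of the first.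
  t₁ = M * (t + w)
  U = 4 * x + w
  N≤ : M * x ≤ suc r′ * (4 * x)
  N≤ = ℕ.≤-reflexive (l r′ x)
    where
    l : ∀ r x → (2 + (1 + r * 2) * 2) * x ≡ suc r * (4 * x)
    l = solve-∀
  reserveᴸ = reserve L L-inj r′ t₁ n<2^w ℕ.≤-refl N≤ (λ _ → all?)
    (λ _ → ℕ.≤-trans (ℕ.*-monoʳ-≤ M x-large) count-all)
  P = proj₁ reserveᴸ
  P-good = proj₂ reserveᴸ
  reserveᴿ = reserve R R-inj r′ t n<2^w ℕ.≤-refl N≤ (λ c j → all? j ×-dec T? (P (L c j)))
    (proj₁ ∘ P-good)
  Q = proj₁ reserveᴿ
  Q-good = proj₂ reserveᴿ
  w≤x : w ≤ x
  w≤x = ℕ.≤-trans (ℕ.m≤n+m w t₁) x-large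
  -- The budget of 11x: the slack takes x, and each reserve takes U = 4x + w, at most 5x.
  room : n + x + (U + U) ≤ M * x
  room = begin
    n + x + (4 * x + w + (4 * x + w))  ≤⟨ ℕ.+-monoʳ-≤ (n + x) (ℕ.+-mono-≤ (ℕ.+-monoʳ-≤ (4 * x) w≤x) (ℕ.+-monoʳ-≤ (4 * x) w≤x)) ⟩
    n + x + (4 * x + x + (4 * x + x))  ≡⟨ l n x ⟩
    n + 11 * x                         ≤⟨ n+11x≤Mx ⟩
    M * x                              ∎
    where
    l : ∀ n x → n + x + (4 * x + x + (4 * x + x)) ≡ n + 11 * x
    l = solve-∀
  few : ∀ k → k * x ≤ n → k + k < t
  few k kx≤n = s≤s (ℕ.+-mono-≤ k≤M k≤M)
    where
    x>0 : NonZero x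
    x>0 = >-nonZero (ℕ.<-≤-trans z<s (ℕ.≤-trans (ℕ.m≤m+n t₁ w) x-large))
    k≤M : k ≤ M
    k≤M = ℕ.*-cancelʳ-≤ k M x {{x>0}} (ℕ.≤-trans kx≤n (ℕ.≤-trans (ℕ.m≤m+n n (11 * x)) n+11x≤Mx))

-- Choice of the parameters

n<[1+n/d]*d : ∀ n d .{{_ : NonZero d}} → n < suc (n / d) * d
n<[1+n/d]*d n d = subst (_< d + n / d * d) (sym (m≡m%n+[m/n]*n n d)) (ℕ.+-monoˡ-< (n / d * d) (m%n<n n d))

k*d≤n⇒k≤n/d : ∀ k n d .{{_ : NonZero d}} → k * d ≤ n → k ≤ n / d
k*d≤n⇒k≤n/d k n d le = subst (_≤ n / d) (m*n/n≡m k d) (/-monoˡ-≤ d le)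

suc≤2^ : ∀ n → suc n ≤ 2 ^ n
suc≤2^ zero    = ℕ.≤-refl
suc≤2^ (suc n) = begin
  suc (suc n)    ≤⟨ s≤s (suc≤2^ n) ⟩
  1 + 2 ^ n      ≤⟨ ℕ.+-monoˡ-≤ (2 ^ n) (ℕ.m^n>0 2 n) ⟩
  2 ^ n + 2 ^ n  ≡⟨ cong (_+_ (2 ^ n)) (ℕ.+-identityʳ (2 ^ n)) ⟨
  2 ^ suc n      ∎

-- At d = 0 the left side is below (E+1)^3, which is at most (2^E)^3. Raising `d` by one doubles the
-- right side and at most doubles the left.
linear≤2^ : ∀ E d → suc (3 * E + d) * E ≤ 2 ^ (3 * E + d)
linear≤2^ E zero = begin
  suc (3 * E + 0) * E          ≤⟨ ℕ.m≤m+n _ (E * E * E + 2 * E + 1) ⟩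
  suc (3 * E + 0) * E + (E * E * E + 2 * E + 1)  ≡⟨ l E ⟩
  suc E * (suc E * suc E)      ≤⟨ ℕ.*-mono-≤ (suc≤2^ E) (ℕ.*-mono-≤ (suc≤2^ E) (suc≤2^ E)) ⟩
  2 ^ E * (2 ^ E * 2 ^ E)      ≡⟨ cong (2 ^ E *_) (ℕ.^-distribˡ-+-* 2 E E) ⟨
  2 ^ E * 2 ^ (E + E)          ≡⟨ ℕ.^-distribˡ-+-* 2 E (E + E) ⟨
  2 ^ (E + (E + E))            ≡⟨ cong (2 ^_) (l₁ E) ⟩
  2 ^ (3 * E + 0)              ∎
  where
  l : ∀ E → suc (3 * E + 0) * E + (E * E * E + 2 * E + 1) ≡ suc E * (suc E * suc E)
  l = solve-∀
  l₁ : ∀ E → E + (E + E) ≡ 3 * E + 0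
  l₁ = solve-∀
linear≤2^ E (suc d) = begin
  suc (3 * E + suc d) * E          ≤⟨ ℕ.m≤m+n _ ((3 * E + d) * E) ⟩
  suc (3 * E + suc d) * E + (3 * E + d) * E  ≡⟨ l E d ⟩
  2 * (suc (3 * E + d) * E)        ≤⟨ ℕ.*-monoʳ-≤ 2 (linear≤2^ E d) ⟩
  2 * 2 ^ (3 * E + d)              ≡⟨ cong (2 ^_) (ℕ.+-suc (3 * E) d) ⟨
  2 ^ (3 * E + suc d)              ∎
  where
  l : ∀ E d → suc (3 * E + suc d) * E + (3 * E + d) * E ≡ 2 * (suc (3 * E + d) * E)
  l = solve-∀

-- With 1/s ≤ ε, keep M x ≤ (1 + 1/s) n edges of each colour.  A reserved set touches about
-- 4 x of them, and the slack beyond n is x; w exceeds log₂ n but is small compared with x.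
module Parameters (s′ : ℕ) where

  s  = suc s′
  -- This makes M = 24s + 12 = D + 11, so that n ≤ D x gives n + 11x ≤ M x. As 11/D < 1/(2s), half
  -- of the surplus n/s suffices; the other half pays for rounding `x` up.
  r′ = 2 + 6 * s
  M  = 2 + (1 + r′ * 2) * 2
  D  = 1 + 24 * s
  -- The coefficient of `w` in `x-large` once the constant term is multiplied by w ≥ 1.
  C  = M + 1 + M * suc (M + M)
  E  = D * C

  -- The first summand forces w ≥ 3E, where `linear≤2^` starts; the second covers the rounding of
  -- `x`, which costs `M` edges.
  threshold : ℕ
  threshold = 3 * E * E + 2 * (s * M)

  M≡D+11 : M ≡ D + 11
  M≡D+11 = l s
    where
    l : ∀ s → 2 + (1 + (2 + 6 * s) * 2) * 2 ≡ 1 + 24 * s + 11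
    l = solve-∀

  module _ {n : ℕ} (large : threshold ≤ n) where

    instance
      E≢0 : NonZero E
      E≢0 = ℕ.m*n≢0 D C

    w x : ℕ
    w = n / E
    x = suc (n / D)

    3E≤w : 3 * E ≤ w
    3E≤w = k*d≤n⇒k≤n/d (3 * E) n E (ℕ.≤-trans (ℕ.m≤m+n (3 * E * E) (2 * (s * M))) large)

    n<2^w : n < 2 ^ w
    n<2^w = ℕ.<-≤-trans (n<[1+n/d]*d n E)
      (subst (λ w → suc w * E ≤ 2 ^ w) (ℕ.m+[n∸m]≡n 3E≤w) (linear≤2^ E (w ∸ 3 * E)))

    w>0 : 1 ≤ w
    w>0 = ℕ.≤-trans (>-nonZero⁻¹ (3 * E) {{ℕ.m*n≢0 3 E}}) 3E≤w

    x-large : M * (suc (M + M) + w) + w ≤ x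
    x-large = begin
      M * (suc (M + M) + w) + w      ≡⟨ l M (suc (M + M)) w ⟩
      (M + 1) * w + M * suc (M + M) * 1  ≤⟨ ℕ.+-monoʳ-≤ ((M + 1) * w) (ℕ.*-monoʳ-≤ (M * suc (M + M)) w>0) ⟩
      (M + 1) * w + M * suc (M + M) * w  ≡⟨ ℕ.*-distribʳ-+ w (M + 1) (M * suc (M + M)) ⟨
      C * w                          ≤⟨ k*d≤n⇒k≤n/d (C * w) n D CwD≤n ⟩
      n / D                          ≤⟨ ℕ.n≤1+n _ ⟩
      x                              ∎
      where
      l : ∀ M t w → M * (t + w) + w ≡ (M + 1) * w + M * t * 1
      l = solve-∀
      CwD≤n : C * w * D ≤ n
      CwD≤n = ℕ.≤-trans (ℕ.≤-reflexive (l₁ C w D)) (m/n*n≤m n E)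
        where
        l₁ : ∀ C w D → C * w * D ≡ w * (D * C)
        l₁ = solve-∀

    n+11x≤Mx : n + 11 * x ≤ M * x
    n+11x≤Mx = begin
      n + 11 * x      ≤⟨ ℕ.+-monoˡ-≤ (11 * x) (ℕ.<⇒≤ (n<[1+n/d]*d n D)) ⟩
      x * D + 11 * x  ≡⟨ l x D ⟩
      (D + 11) * x    ≡⟨ cong (_* x) M≡D+11 ⟨
      M * x           ∎
      where
      l : ∀ x D → x * D + 11 * x ≡ (D + 11) * x
      l = solve-∀

    Mx≤ : ∀ {m} → suc s * n ≤ s * m → M * x ≤ m
    Mx≤ {m} [1+s]n≤sm = ℕ.*-cancelˡ-≤ (2 * s) (begin
      2 * s * (M * x)                               ≡⟨ l s M (n / D) ⟩
      2 * s * (M * (n / D)) + 2 * (s * M)           ≡⟨ cong (λ z → 2 * s * (z * (n / D)) + 2 * (s * M)) M≡D+11 ⟩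
      2 * s * ((D + 11) * (n / D)) + 2 * (s * M)    ≤⟨ ℕ.+-monoˡ-≤ _ (ℕ.≤-trans (ℕ.m≤m+n _ ((2 * s + 1) * (n / D))) (ℕ.≤-reflexive (l₁ s (n / D)))) ⟩
      (2 * s + 1) * (n / D * D) + 2 * (s * M)       ≤⟨ ℕ.+-mono-≤ (ℕ.*-monoʳ-≤ (2 * s + 1) (m/n*n≤m n D)) (ℕ.≤-trans (ℕ.m≤n+m (2 * (s * M)) (3 * E * E)) large) ⟩
      (2 * s + 1) * n + n                           ≡⟨ l₂ s n ⟩
      2 * (suc s * n)                               ≤⟨ ℕ.*-monoʳ-≤ 2 [1+s]n≤sm ⟩
      2 * (s * m)                                   ≡⟨ ℕ.*-assoc 2 s m ⟨
      2 * s * m                                     ∎)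
      where
      l : ∀ s M y → 2 * s * (M * suc y) ≡ 2 * s * (M * y) + 2 * (s * M)
      l = solve-∀
      l₁ : ∀ s y → 2 * s * ((1 + 24 * s + 11) * y) + (2 * s + 1) * y ≡ (2 * s + 1) * (y * (1 + 24 * s))
      l₁ = solve-∀
      l₂ : ∀ s n → (2 * s + 1) * n + n ≡ 2 * (suc s * n)
      l₂ = solve-∀

-- A positive rational is at least the reciprocal of its denominator, which becomes `s`. The
-- comparison moves to unnormalised rationals, whose sums and products have explicit numerators and
-- denominators.
rational-bound : ∀ q → 0ℚ ℚ.< q → ∃[ s′ ] (∀ n m → (1ℚ ℚ.+ q) ℚ.* (ℤ.+ n ℚ./ 1) ℚ.≤ ℤ.+ m ℚ./ 1 →
                                               suc (suc s′) * n ≤ suc s′ * m)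
rational-bound q@(mkℚ (ℤ.+ zero)  d _) (ℚ.*<* (ℤ.+<+ ()))
rational-bound q@(mkℚ (-[1+ _ ]) d _) (ℚ.*<* ())
rational-bound q@(mkℚ (ℤ.+ suc a) d _) _ = d , bound
  where
  bound : ∀ n m → (1ℚ ℚ.+ q) ℚ.* (ℤ.+ n ℚ./ 1) ℚ.≤ ℤ.+ m ℚ./ 1 → suc (suc d) * n ≤ suc d * m
  bound n m le = begin
    suc (suc d) * n                ≤⟨ ℕ.*-monoˡ-≤ n (s≤s (ℕ.+-mono-≤ {1} {suc a} (s≤s z≤n) (ℕ.≤-refl {d}))) ⟩
    suc (suc a + d) * n            ≡⟨ l a d n ⟩
    (1 * suc d + suc a * 1) * n * 1  ≤⟨ ℤ.drop‿+≤+ (subst₂ ℤ._≤_ left right (ℚᵘ.drop-*≤* le′)) ⟩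
    m * (1 * suc d * 1)            ≡⟨ l₁ m d ⟩
    suc d * m                      ∎
    where
    le′ : (mkℚᵘ (ℤ.+ 1) 0 ℚᵘ.+ mkℚᵘ (ℤ.+ suc a) d) ℚᵘ.* mkℚᵘ (ℤ.+ n) 0 ℚᵘ.≤ mkℚᵘ (ℤ.+ m) 0
    le′ = ℚᵘ.≤-respˡ-≃
      (ℚᵘ.≃-trans (ℚ.toℚᵘ-homo-* (1ℚ ℚ.+ q) (ℤ.+ n ℚ./ 1))
        (ℚᵘ.*-cong (ℚ.toℚᵘ-homo-+ 1ℚ q) (ℚ.toℚᵘ-fromℚᵘ (mkℚᵘ (ℤ.+ n) 0))))
      (ℚᵘ.≤-respʳ-≃ (ℚ.toℚᵘ-fromℚᵘ (mkℚᵘ (ℤ.+ m) 0)) (ℚ.toℚᵘ-mono-≤ le))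
    left : (ℤ.+ (1 * suc d + suc a * 1) ℤ.* ℤ.+ n) ℤ.* ℤ.+ 1 ≡ ℤ.+ ((1 * suc d + suc a * 1) * n * 1)
    left = trans (cong (ℤ._* ℤ.+ 1) (sym (ℤ.pos-* (1 * suc d + suc a * 1) n)))
                 (sym (ℤ.pos-* ((1 * suc d + suc a * 1) * n) 1))
    right : ℤ.+ m ℤ.* ℤ.+ (1 * suc d * 1) ≡ ℤ.+ (m * (1 * suc d * 1))
    right = sym (ℤ.pos-* m (1 * suc d * 1))
    l : ∀ a d n → suc (suc a + d) * n ≡ (1 * suc d + suc a * 1) * n * 1
    l = solve-∀
    l₁ : ∀ m d → m * (1 * suc d * 1) ≡ suc d * m
    l₁ = solve-∀

-- From multigraphs to arrays of edges

∣tabulate∣≡count : ∀ {n} {P : Fin n → Set} (P? : Decidable P) → ∣ tabulate (does ∘ P?) ∣ ≡ count P?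
∣tabulate∣≡count {zero}  P? = refl
∣tabulate∣≡count {suc n} P? with P? zero
... | yes _ = cong suc (∣tabulate∣≡count (P? ∘ suc))
... | no  _ = ∣tabulate∣≡count (P? ∘ suc)

∈-tabulate⁺ : ∀ {n} {P : Fin n → Set} (P? : Decidable P) {i : Fin n} → P i → i ∈ tabulate (does ∘ P?)
∈-tabulate⁺ P? {i} p = lookup⇒[]= i _ (trans (lookup∘tabulate (does ∘ P?) i) (dec-true (P? i) p))

∈-tabulate⁻ : ∀ {n} {P : Fin n → Set} (P? : Decidable P) {i : Fin n} → i ∈ tabulate (does ∘ P?) → P i
∈-tabulate⁻ P? {i} i∈ with P? i | trans (sym (lookup∘tabulate (does ∘ P?) i)) ([]=⇒lookup i∈)
... | yes p | _ = p

module _ (G : Multigraph) where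
  open Multigraph G

  module Reduction {n N : ℕ} (bipartite : Bipartite) (χ : EdgeColouring n) (proper : Proper χ)
    (class-large : ∀ c → N ≤ ∣ colourClass χ c ∣) where

    side = proj₁ bipartite

    left right : Edge → Vertex
    left  e = if side (end₁ e) then end₁ e else end₂ e
    right e = if side (end₁ e) then end₂ e else end₁ e

    left-incident : ∀ e → Incident (left e) e
    left-incident e with side (end₁ e)
    ... | true  = inj₁ refl
    ... | false = inj₂ refl

    right-incident : ∀ e → Incident (right e) e
    right-incident e with side (end₁ e)
    ... | true  = inj₂ refl
    ... | false = inj₁ refl

    incident⇒end : ∀ {v} e → Incident v e → v ≡ (if side v then left e else right e)
    incident⇒end e (inj₁ refl) with side (end₁ e)
    ... | true  = refl
    ... | false = refl
    incident⇒end e (inj₂ refl) with side (end₁ e) | side (end₂ e) | proj₂ bipartite e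
    ... | true  | true  | ≢ = ⊥-elim (≢ refl)
    ... | true  | false | _ = refl
    ... | false | true  | _ = refl
    ... | false | false | ≢ = ⊥-elim (≢ refl)

    -- Bipartiteness enters here: the side of the shared vertex decides whether it is the left end
    -- of both edges or the right end of both. So a `Transversal`, which compares left with left and
    -- right with right, yields a matching.
    share⇒common-end : ∀ {e f} → ShareVertex e f → left e ≡ left f ⊎ right e ≡ right f
    share⇒common-end {e} {f} (v , ve , vf) with side v | trans (sym (incident⇒end e ve)) (incident⇒end f vf)
    ... | true  | eq = inj₁ eq
    ... | false | eq = inj₂ eq

    colour? : ∀ c → Decidable (λ e → χ e ≡ c)
    colour? c e = χ e Fin.≟ c

    N≤count : ∀ c → N ≤ count (colour? c)
    N≤count c = subst (N ≤_) (∣tabulate∣≡count (colour? c)) (class-large c)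

    edge : Fin n → Fin N → Edge
    edge c i = element (colour? c) (inject≤ i (N≤count c))

    χ-edge : ∀ c i → χ (edge c i) ≡ c
    χ-edge c i = element-satisfies (colour? c) (inject≤ i (N≤count c))

    edge-injective : ∀ c {i j} → edge c i ≡ edge c j → i ≡ j
    edge-injective c eq = Fin.inject≤-injective (N≤count c) (N≤count c) _ _ (element-injective (colour? c) eq)

    same-colour-sharing⇒≡ : ∀ {e f} → χ e ≡ χ f → ShareVertex e f → e ≡ f
    same-colour-sharing⇒≡ {e} {f} χ≡ share with e Fin.≟ f
    ... | yes e≡f = e≡f
    ... | no  e≢f = ⊥-elim (proper e f e≢f share χ≡)

    ends-injective : (end : Edge → Vertex) → (∀ e → Incident (end e) e) → RowInjective (λ c i → end (edge c i))
    ends-injective end incident c {i} {j} eq = edge-injective c (same-colour-sharing⇒≡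
      (trans (χ-edge c i) (sym (χ-edge c j)))
      (end (edge c i) , incident (edge c i) , subst (λ v → Incident v (edge c j)) (sym eq) (incident (edge c j))))

    rainbow-matching : Transversal (λ c i → left (edge c i)) (λ c i → right (edge c i)) →
                       ∃[ M ] (IsMatching M × IsRainbow χ M × UsesEveryColour χ M)
    rainbow-matching (h , left-inj , right-inj) = M , matching , rainbow , every
      where
      chosen : Fin n → Edge
      chosen c = edge c (h c)
      -- Membership asks an edge to be the chosen one of its own colour, so two members of equal
      -- colour coincide at once.
      chosen? : Decidable (λ e → e ≡ chosen (χ e))
      chosen? e = e Fin.≟ chosen (χ e)
      M = tabulate (does ∘ chosen?)
      rainbow : IsRainbow χ M
      rainbow e f e∈ f∈ e≢f χ≡ =
        e≢f (trans (∈-tabulate⁻ chosen? e∈) (trans (cong chosen χ≡) (sym (∈-tabulate⁻ chosen? f∈))))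
      matching : IsMatching M
      matching e f e∈ f∈ e≢f share with share⇒common-end share
      ... | inj₁ eq = rainbow e f e∈ f∈ e≢f
        (left-inj (subst₂ (λ a b → left a ≡ left b) (∈-tabulate⁻ chosen? e∈) (∈-tabulate⁻ chosen? f∈) eq))
      ... | inj₂ eq = rainbow e f e∈ f∈ e≢f
        (right-inj (subst₂ (λ a b → right a ≡ right b) (∈-tabulate⁻ chosen? e∈) (∈-tabulate⁻ chosen? f∈) eq))
      every : UsesEveryColour χ M
      every c = chosen c , ∈-tabulate⁺ chosen? (cong chosen (sym (χ-edge c (h c)))) , χ-edge c (h c)

theorem1p3 : (ε : ℝ) → 0ᴿ <ᴿ ε →
    ∃[ N₀ ] ((n : ℕ) → n ≥ N₀ →
    (G : Multigraph) → let open Multigraph G in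
    Bipartite →
    (χ : EdgeColouring n) → Proper χ →
    ((c : Fin n) → [1+ ε ]· n ≤ ∣ colourClass χ c ∣) →
    ∃[ M ] (IsMatching M × IsRainbow χ M × UsesEveryColour χ M))
theorem1p3 ε (q , 0<q , q<ε) = let (s′ , bound) = rational-bound q 0<q in
  Parameters.threshold s′ , λ n n≥N₀ G bipartite χ proper class-large →
    let open Parameters s′
        open Reduction G bipartite χ proper (λ c → Mx≤ n≥N₀ (bound n _ (class-large c q q<ε)))
    in rainbow-matching (transversal r′ _ _
         (ends-injective left left-incident) (ends-injective right right-incident)
         (n<2^w n≥N₀) (x-large n≥N₀) (n+11x≤Mx n≥N₀))
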